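{- Every sequent provable in $\mathsf{RTC}_{G}$ is provable in $\mathsf{CRTC}^{\omega}_{G}$ (i.e. $\mathsf{CRTC}^{\omega}_{G}\supseteq\mathsf{RTC}_{G}$); consequently $\mathsf{CRTC}^{\omega}_{G}$ is complete with respect to Henkin semantics, i.e. every sequent valid in all Henkin structures is provable in $\mathsf{CRTC}^{\omega}_{G}$.
   Context: Formulas of $\mathcal{L}_{\mathsf{RTC}}$: first-order formulas with equality extended by $(RTC_{x,y}\,\varphi)(s,t)$ for distinct variables $x,y$ bound in $\varphi$ and terms $s,t$. Henkin semantics: a frame is $\langle D,I,\mathcal{D}\rangle$ with $\langle D,I\rangle$ a first-order structure and $\mathcal{D}\subseteq\wp(D)$; formulas are interpreted as usual except $M,v\models(RTC_{x,y}\varphi)(s,t)$ iff for every $A\in\mathcal{D}$, if $v(s)\in A$ and for all $a,b\in D$, $a\in A$ and $M,v[x:=a,y:=b]\models\varphi$ imply $b\in A$, then $v(t)\in A$. A Henkin structure is a frame with $\{a\in D\mid M,v[x:=a]\models\varphi\}\in\mathcal{D}$ for every formula $\varphi$, variable $x$ and valuation $v$. A sequent $\Gamma\Rightarrow\Delta$ is Henkin-valid if in every Henkin structure and valuation satisfying all of $\Gamma$ some formula of $\Delta$ holds. $\mathcal{LK}_=$: classical sequent calculus with axiom $\varphi\Rightarrow\varphi$, weakening, usual connective/quantifier rules (eigenvariable conditions), $(=L_1)$: from $\Gamma\Rightarrow\varphi[s/x],\Delta$ infer $\Gamma,s=t\Rightarrow\varphi[t/x],\Delta$, $(=L_2)$: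 from $\Gamma\Rightarrow\varphi[t/x],\Delta$ infer $\Gamma,s=t\Rightarrow\varphi[s/x],\Delta$, $(=R)$: $\Rightarrow t=t$, Cut, and (Subst): from $\Gamma\Rightarrow\Delta$ infer $\Gamma\theta\Rightarrow\Delta\theta$. Rules: (Refl) $\Gamma\Rightarrow\Delta,(RTC_{x,y}\varphi)(s,s)$; (Trans) from $\Gamma\Rightarrow\Delta,(RTC_{x,y}\varphi)(s,r)$ and $\Gamma\Rightarrow\Delta,\varphi[r/x,t/y]$ infer $\Gamma\Rightarrow\Delta,(RTC_{x,y}\varphi)(s,t)$; (Ind) from $\Gamma,\psi(x),\varphi(x,y)\Rightarrow\Delta,\psi[y/x]$ infer $\Gamma,\psi[s/x],(RTC_{x,y}\varphi)(s,t)\Rightarrow\Delta,\psi[t/x]$ with $x\notin fv(\Gamma,\Delta)$, $y\notin fv(\Gamma,\Delta,\psi)$; (Case) from $\Gamma,s=t\Rightarrow\Delta$ and $\Gamma,(RTC_{x,y}\varphi)(s,z),\varphi[z/x,t/y]\Rightarrow\Delta$ infer $\Gamma,(RTC_{x,y}\varphi)(s,t)\Rightarrow\Delta$, $z$ fresh, where $(RTC_{x,y}\varphi)(s,z)$ is the immediate ancestor of the principal formula. $\mathsf{RTC}_G$ = $\mathcal{LK}_=$ + (Refl), (Trans), (Ind), with finite derivation trees as proofs. $\mathsf{RTC}^{\omega}_G$ = $\mathcal{LK}_=$ + (Refl), (Trans), (Case); a pre-proof is a possibly infinite derivation tree with no open leaves; a trace pair $(\tau,\tau')$ between $RTC$-formulas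 in the antecedents of a conclusion and a premise holds if the rule is (Subst) with $\tau=\tau'\theta$, or the rule is (Case) and $\tau$ is principal and $\tau'$ its immediate ancestor (progressing), or $\tau=\tau'$ otherwise; a trace follows a path if from some offset consecutive formulas are trace pairs along it; a proof is a pre-proof in which every infinite path is followed by a trace with infinitely many progressing pairs. $\mathsf{CRTC}^{\omega}_G$ consists of the finite and regular (finitely many distinct subtrees) $\mathsf{RTC}^{\omega}_G$ proofs. -}

module Defs where

open import Level using (0ℓ)
open import Data.Nat using (ℕ; zero; suc; _≤_; _≟_)
open import Data.Fin using (Fin; zero; suc; toℕ)
open import Data.Vec using (Vec; []; _∷_)
open import Data.List using (List; []; _∷_; _++_; map; concatMap; length; lookup)
open import Data.List.Membership.Propositional using (_∈_; _∉_)
open import Data.List.Relation.Binary.Subset.Propositional using (_⊆_)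
open import Data.List.Relation.Unary.All using (All)
open import Data.List.Relation.Unary.Any using (Any)
open import Data.Product using (Σ; _×_; _,_)
open import Data.Sum using (_⊎_)
open import Data.Empty using (⊥)
open import Relation.Binary.PropositionalEquality using (_≡_; _≢_)
open import Relation.Nullary using (¬_; yes; no)

record Signature : Set₁ where
  field
    Fun    : Set
    Pred   : Set
    farity : Fun → ℕ
    parity : Pred → ℕ

module _ (L : Signature) where
  open Signature L

  -- Syntax (locally nameless): free variables are names in ℕ,
  -- bound variables are well-scoped de Bruijn indices.  Hence formulas
  -- are identified up to α-equivalence.  'Form n' has n bound variables
  -- in scope; formulas of sequents are in 'Form 0'.

  data Term (n : ℕ) : Set where
    var  : ℕ → Term n
    bvar : Fin n → Term n
    app  : (f : Fun) → Vec (Term n) (farity f) → Term n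

  -- (RTC_{x,y} φ)(s,t) is  rtc φ s t  with φ : Form (2 + n),
  -- bound index 0 playing the role of x and index 1 that of y.
  data Form (n : ℕ) : Set where
    atom  : (P : Pred) → Vec (Term n) (parity P) → Form n
    _≐_   : Term n → Term n → Form n
    ¬'_   : Form n → Form n
    _∧'_  : Form n → Form n → Form n
    _∨'_  : Form n → Form n → Form n
    _⇒'_  : Form n → Form n → Form n
    ∀'_   : Form (suc n) → Form n
    ∃'_   : Form (suc n) → Form n
    rtc   : Form (suc (suc n)) → Term n → Term n → Form n

  mutual
    renT : ∀ {m n} → (Fin m → Fin n) → Term m → Term n
    renT ρ (var x)    = var x
    renT ρ (bvar i)   = bvar (ρ i)
    renT ρ (app f ts) = app f (renTs ρ ts)

    renTs : ∀ {m n k} → (Fin m → Fin n) → Vec (Term m) k → Vec (Term n) k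
    renTs ρ []       = []
    renTs ρ (t ∷ ts) = renT ρ t ∷ renTs ρ ts

  weaken : ∀ {n} → Term n → Term (suc n)
  weaken = renT suc

  mutual
    subT : ∀ {m n} → (ℕ → Term n) → (Fin m → Term n) → Term m → Term n
    subT θ σ (var x)    = θ x
    subT θ σ (bvar i)   = σ i
    subT θ σ (app f ts) = app f (subTs θ σ ts)

    subTs : ∀ {m n k} → (ℕ → Term n) → (Fin m → Term n) → Vec (Term m) k → Vec (Term n) k
    subTs θ σ []       = []
    subTs θ σ (t ∷ ts) = subT θ σ t ∷ subTs θ σ ts

  wkS : ∀ {n} → (ℕ → Term n) → ℕ → Term (suc n)
  wkS θ x = weaken (θ x)

  liftS : ∀ {m n} → (Fin m → Term n) → Fin (suc m) → Term (suc n)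
  liftS σ zero    = bvar zero
  liftS σ (suc i) = weaken (σ i)

  subF : ∀ {m n} → (ℕ → Term n) → (Fin m → Term n) → Form m → Form n
  subF θ σ (atom P ts) = atom P (subTs θ σ ts)
  subF θ σ (s ≐ t)     = subT θ σ s ≐ subT θ σ t
  subF θ σ (¬' φ)      = ¬' subF θ σ φ
  subF θ σ (φ ∧' ψ)    = subF θ σ φ ∧' subF θ σ ψ
  subF θ σ (φ ∨' ψ)    = subF θ σ φ ∨' subF θ σ ψ
  subF θ σ (φ ⇒' ψ)    = subF θ σ φ ⇒' subF θ σ ψ
  subF θ σ (∀' φ)      = ∀' subF (wkS θ) (liftS σ) φ
  subF θ σ (∃' φ)      = ∃' subF (wkS θ) (liftS σ) φ
  subF θ σ (rtc φ s t) =
    rtc (subF (wkS (wkS θ)) (liftS (liftS σ)) φ) (subT θ σ s) (subT θ σ t)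

  σ₁ : ∀ {n} → Term n → Fin (suc n) → Term n
  σ₁ t zero    = t
  σ₁ t (suc i) = bvar i

  inst1 : ∀ {n} → Form (suc n) → Term n → Form n
  inst1 φ t = subF var (σ₁ t) φ

  σ₂ : ∀ {n} → Term n → Term n → Fin (suc (suc n)) → Term n
  σ₂ a b zero          = a
  σ₂ a b (suc zero)    = b
  σ₂ a b (suc (suc i)) = bvar i

  inst2 : ∀ {n} → Form (suc (suc n)) → Term n → Term n → Form n
  inst2 φ a b = subF var (σ₂ a b) φ

  substF : (ℕ → Term 0) → Form 0 → Form 0
  substF θ φ = subF θ bvar φ

  mutual
    fvT : ∀ {n} → Term n → List ℕ
    fvT (var x)    = x ∷ []
    fvT (bvar i)   = []
    fvT (app f ts) = fvTs ts

    fvTs : ∀ {n k} → Vec (Term n) k → List ℕ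
    fvTs []       = []
    fvTs (t ∷ ts) = fvT t ++ fvTs ts

  fvF : ∀ {n} → Form n → List ℕ
  fvF (atom P ts) = fvTs ts
  fvF (s ≐ t)     = fvT s ++ fvT t
  fvF (¬' φ)      = fvF φ
  fvF (φ ∧' ψ)    = fvF φ ++ fvF ψ
  fvF (φ ∨' ψ)    = fvF φ ++ fvF ψ
  fvF (φ ⇒' ψ)    = fvF φ ++ fvF ψ
  fvF (∀' φ)      = fvF φ
  fvF (∃' φ)      = fvF φ
  fvF (rtc φ s t) = fvF φ ++ fvT s ++ fvT t

  fvL : List (Form 0) → List ℕ
  fvL = concatMap fvF

  data IsRTC : Form 0 → Set where
    isRTC : ∀ {φ s t} → IsRTC (rtc φ s t)

  -- Sequents (antecedent and succedent read as finite sets; the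
  -- weakening rule 'wk' is stated up to set inclusion, so it also
  -- provides exchange and contraction).

  infix 4 _⊢_
  record Sequent : Set where
    constructor _⊢_
    field
      ante : List (Form 0)
      succ : List (Form 0)
  open Sequent public

  data Core : Sequent → List Sequent → Set where
    ax    : ∀ φ → Core ((φ ∷ []) ⊢ (φ ∷ [])) []
    wk    : ∀ {Γ Γ' Δ Δ'} → Γ ⊆ Γ' → Δ ⊆ Δ' →
            Core (Γ' ⊢ Δ') ((Γ ⊢ Δ) ∷ [])
    negL  : ∀ {Γ Δ} φ → Core ((¬' φ) ∷ Γ ⊢ Δ) ((Γ ⊢ φ ∷ Δ) ∷ [])
    negR  : ∀ {Γ Δ} φ → Core (Γ ⊢ (¬' φ) ∷ Δ) ((φ ∷ Γ ⊢ Δ) ∷ [])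
    andL  : ∀ {Γ Δ} φ ψ → Core ((φ ∧' ψ) ∷ Γ ⊢ Δ) ((φ ∷ ψ ∷ Γ ⊢ Δ) ∷ [])
    andR  : ∀ {Γ Δ} φ ψ → Core (Γ ⊢ (φ ∧' ψ) ∷ Δ)
                                ((Γ ⊢ φ ∷ Δ) ∷ (Γ ⊢ ψ ∷ Δ) ∷ [])
    orL   : ∀ {Γ Δ} φ ψ → Core ((φ ∨' ψ) ∷ Γ ⊢ Δ)
                                ((φ ∷ Γ ⊢ Δ) ∷ (ψ ∷ Γ ⊢ Δ) ∷ [])
    orR   : ∀ {Γ Δ} φ ψ → Core (Γ ⊢ (φ ∨' ψ) ∷ Δ) ((Γ ⊢ φ ∷ ψ ∷ Δ) ∷ [])
    impL  : ∀ {Γ Δ} φ ψ → Core ((φ ⇒' ψ) ∷ Γ ⊢ Δ)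
                                ((Γ ⊢ φ ∷ Δ) ∷ (ψ ∷ Γ ⊢ Δ) ∷ [])
    impR  : ∀ {Γ Δ} φ ψ → Core (Γ ⊢ (φ ⇒' ψ) ∷ Δ) ((φ ∷ Γ ⊢ ψ ∷ Δ) ∷ [])
    allL  : ∀ {Γ Δ} (φ : Form 1) (t : Term 0) →
            Core ((∀' φ) ∷ Γ ⊢ Δ) ((inst1 φ t ∷ Γ ⊢ Δ) ∷ [])
    allR  : ∀ {Γ Δ} (φ : Form 1) (a : ℕ) →
            a ∉ fvF φ → a ∉ fvL Γ → a ∉ fvL Δ →
            Core (Γ ⊢ (∀' φ) ∷ Δ) ((Γ ⊢ inst1 φ (var a) ∷ Δ) ∷ [])
    exL   : ∀ {Γ Δ} (φ : Form 1) (a : ℕ) →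
            a ∉ fvF φ → a ∉ fvL Γ → a ∉ fvL Δ →
            Core ((∃' φ) ∷ Γ ⊢ Δ) ((inst1 φ (var a) ∷ Γ ⊢ Δ) ∷ [])
    exR   : ∀ {Γ Δ} (φ : Form 1) (t : Term 0) →
            Core (Γ ⊢ (∃' φ) ∷ Δ) ((Γ ⊢ inst1 φ t ∷ Δ) ∷ [])
    eqL₁  : ∀ {Γ Δ} (φ : Form 1) (s t : Term 0) →
            Core ((s ≐ t) ∷ Γ ⊢ inst1 φ t ∷ Δ) ((Γ ⊢ inst1 φ s ∷ Δ) ∷ [])
    eqL₂  : ∀ {Γ Δ} (φ : Form 1) (s t : Term 0) →
            Core ((s ≐ t) ∷ Γ ⊢ inst1 φ s ∷ Δ) ((Γ ⊢ inst1 φ t ∷ Δ) ∷ [])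
    eqR   : ∀ (t : Term 0) → Core ([] ⊢ (t ≐ t) ∷ []) []
    cut   : ∀ {Γ Δ} φ → Core (Γ ⊢ Δ) ((Γ ⊢ φ ∷ Δ) ∷ (φ ∷ Γ ⊢ Δ) ∷ [])
    subst : ∀ {Γ Δ} (θ : ℕ → Term 0) →
            Core (map (substF θ) Γ ⊢ map (substF θ) Δ) ((Γ ⊢ Δ) ∷ [])
    rtcRefl  : ∀ {Γ Δ} (φ : Form 2) (s : Term 0) →
               Core (Γ ⊢ rtc φ s s ∷ Δ) []
    rtcTrans : ∀ {Γ Δ} (φ : Form 2) (s r t : Term 0) →
               Core (Γ ⊢ rtc φ s t ∷ Δ)
                    ((Γ ⊢ rtc φ s r ∷ Δ) ∷ (Γ ⊢ inst2 φ r t ∷ Δ) ∷ [])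

  data GRule : Sequent → List Sequent → Set where
    core : ∀ {C Ps} → Core C Ps → GRule C Ps
    ind  : ∀ {Γ Δ} (ψ : Form 1) (φ : Form 2) (s t : Term 0) (a b : ℕ) →
           a ≢ b →
           a ∉ fvL Γ → a ∉ fvL Δ → a ∉ fvF ψ → a ∉ fvF φ →
           b ∉ fvL Γ → b ∉ fvL Δ → b ∉ fvF ψ → b ∉ fvF φ →
           GRule (inst1 ψ s ∷ rtc φ s t ∷ Γ ⊢ inst1 ψ t ∷ Δ)
                 ((inst1 ψ (var a) ∷ inst2 φ (var a) (var b) ∷ Γ
                     ⊢ inst1 ψ (var b) ∷ Δ) ∷ [])

  data CRule : Sequent → List Sequent → Set where
    core : ∀ {C Ps} → Core C Ps → CRule C Ps
    case : ∀ {Γ Δ} (φ : Form 2) (s t : Term 0) (z : ℕ) →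
           z ∉ fvL Γ → z ∉ fvL Δ → z ∉ fvF (rtc φ s t) →
           CRule (rtc φ s t ∷ Γ ⊢ Δ)
                 (((s ≐ t) ∷ Γ ⊢ Δ) ∷
                  (rtc φ s (var z) ∷ inst2 φ (var z) t ∷ Γ ⊢ Δ) ∷ [])

  data RTCProof : Sequent → Set where
    by : ∀ {C Ps} → GRule C Ps → All RTCProof Ps → RTCProof C

  RTCProvable : Sequent → Set
  RTCProvable S = RTCProof S

  -- Trace pairs for RTC^ω_G.
  -- TP r k P τ τ' : (τ, τ') is a (non-progressing) trace pair between the
  -- conclusion of r and its k-th premise P.
  -- Prog r k τ τ' : (τ, τ') is a progressing trace pair.

  idPair : Sequent → Sequent → Form 0 → Form 0 → Set
  idPair C P τ τ' = IsRTC τ × τ ∈ ante C × τ' ∈ ante P × τ ≡ τ'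

  TPcore : ∀ {C Ps} → Core C Ps → Sequent → Form 0 → Form 0 → Set
  TPcore (subst θ) P τ τ' = IsRTC τ' × τ' ∈ ante P × τ ≡ substF θ τ'
  TPcore {C} _     P τ τ' = idPair C P τ τ'

  TP : ∀ {C Ps} → CRule C Ps → ℕ → Sequent → Form 0 → Form 0 → Set
  TP (core r)               k P τ τ' = TPcore r P τ τ'
  TP {C} (case _ _ _ _ _ _ _) k P τ τ' = idPair C P τ τ'

  Prog : ∀ {C Ps} → CRule C Ps → ℕ → Form 0 → Form 0 → Set
  Prog (core r)               k τ τ' = ⊥
  Prog (case φ s t z _ _ _)   k τ τ' =
    k ≡ 1 × τ ≡ rtc φ s t × τ' ≡ rtc φ s (var z)

  -- Regular pre-proofs, represented as finite graphs (their unfoldings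
  -- are exactly the regular, i.e. finitely-many-distinct-subtrees,
  -- derivation trees; finite trees are the acyclic case).  Every node
  -- carries a rule instance whose premises are the sequents of its
  -- children, so there are no open leaves.

  record PreProof (S : Sequent) : Set where
    field
      size   : ℕ
      seqAt  : Fin size → Sequent
      root   : Fin size
      rootOK : seqAt root ≡ S
      prems  : Fin size → List (Fin size)
      ruleAt : (i : Fin size) → CRule (seqAt i) (map seqAt (prems i))

  record Path {S : Sequent} (G : PreProof S) : Set where
    open PreProof G
    field
      node  : ℕ → Fin size
      start : node 0 ≡ root
      dir   : (k : ℕ) → Fin (length (prems (node k)))
      step  : (k : ℕ) → node (suc k) ≡ lookup (prems (node k)) (dir k)

  GoodTrace : ∀ {S} (G : PreProof S) → Path G → Set
  GoodTrace G p =
    Σ ℕ λ m → Σ (ℕ → Form 0) λ τ →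
      ((k : ℕ) → m ≤ k →
         TP   (ruleAt (node k)) (toℕ (dir k)) (seqAt (node (suc k))) (τ k) (τ (suc k))
       ⊎ Prog (ruleAt (node k)) (toℕ (dir k)) (τ k) (τ (suc k)))
      × ((j : ℕ) → Σ ℕ λ k → j ≤ k × m ≤ k ×
           Prog (ruleAt (node k)) (toℕ (dir k)) (τ k) (τ (suc k)))
    where
      open PreProof G
      open Path p

  CRTCProvable : Sequent → Set
  CRTCProvable S = Σ (PreProof S) λ G → (p : Path G) → GoodTrace G p

  -- Henkin semantics.  The family 𝒟 ⊆ ℘(D) is given as an indexed
  -- family of subsets  mem i  (i : Idx).

  record Frame : Set₁ where
    field
      D     : Set
      funI  : (f : Fun) → Vec D (farity f) → D
      predI : (P : Pred) → Vec D (parity P) → Set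
      Idx   : Set
      mem   : Idx → D → Set

  module _ (M : Frame) where
    open Frame M

    ext : ∀ {n} → (Fin n → D) → D → Fin (suc n) → D
    ext ρ a zero    = a
    ext ρ a (suc i) = ρ i

    mutual
      evalT : ∀ {n} → (ℕ → D) → (Fin n → D) → Term n → D
      evalT v ρ (var x)    = v x
      evalT v ρ (bvar i)   = ρ i
      evalT v ρ (app f ts) = funI f (evalTs v ρ ts)

      evalTs : ∀ {n k} → (ℕ → D) → (Fin n → D) → Vec (Term n) k → Vec D k
      evalTs v ρ []       = []
      evalTs v ρ (t ∷ ts) = evalT v ρ t ∷ evalTs v ρ ts

    Sat : ∀ {n} → (ℕ → D) → (Fin n → D) → Form n → Set
    Sat v ρ (atom P ts) = predI P (evalTs v ρ ts)
    Sat v ρ (s ≐ t)     = evalT v ρ s ≡ evalT v ρ t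
    Sat v ρ (¬' φ)      = ¬ Sat v ρ φ
    Sat v ρ (φ ∧' ψ)    = Sat v ρ φ × Sat v ρ ψ
    Sat v ρ (φ ∨' ψ)    = Sat v ρ φ ⊎ Sat v ρ ψ
    Sat v ρ (φ ⇒' ψ)    = Sat v ρ φ → Sat v ρ ψ
    Sat v ρ (∀' φ)      = (a : D) → Sat v (ext ρ a) φ
    Sat v ρ (∃' φ)      = Σ D λ a → Sat v (ext ρ a) φ
    Sat v ρ (rtc φ s t) =
      (i : Idx) → mem i (evalT v ρ s) →
      ((a b : D) → mem i a → Sat v (ext (ext ρ b) a) φ → mem i b) →
      mem i (evalT v ρ t)

    noBound : Fin 0 → D
    noBound ()

    update : (ℕ → D) → ℕ → D → ℕ → D
    update v x a y with y ≟ x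
    ... | yes _ = a
    ... | no  _ = v y

    IsHenkin : Set
    IsHenkin = (φ : Form 0) (x : ℕ) (v : ℕ → D) →
      Σ Idx λ i → (a : D) →
        (mem i a → Sat (update v x a) noBound φ) ×
        (Sat (update v x a) noBound φ → mem i a)

  HenkinValid : Sequent → Set₁
  HenkinValid S =
    (M : Frame) → IsHenkin M → (v : ℕ → Frame.D M) →
    All (λ φ → Sat M v (noBound M) φ) (ante S) →
    Any (λ φ → Sat M v (noBound M) φ) (succ S)

{-# OPTIONS --safe #-}

-- An (Ind) inference with premise ψ(a), φ(a,b), Γ ⇒ ψ(b), Δ is replaced by a
-- cycle through R(z) := RTC φ(s,z), ψ(s), Γ ⇒ ψ(z), Δ with z fresh.  (Case) on
-- R(z) leaves s = z, settled by (=L₁), and RTC φ(s,w), φ(w,z), ψ(s), Γ ⇒ ψ(z), Δ;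
-- a cut on ψ(w) splits the latter into the substitution instance R(w), which
-- closes the cycle, and an instance of the premise of (Ind).  The traced formula
-- RTC φ(s,z) progresses at every (Case).  A path in the resulting graph either
-- leaves the cycle for good or follows this trace.
--
-- RTC_G itself is Henkin complete: an unprovable sequent is extended, by deciding
-- all formulas over its finitely many symbols and adding Henkin witnesses, to a
-- complete theory T.  Its term model, with all definable sets as the Henkin
-- family, refutes the sequent.  An RTC formula in T holds in the model by (Ind);
-- conversely, the definable set {x | RTC χ(s,x)} contains s and is closed under χ
-- by (Refl) and (Trans).

module Submission where

open import Defs
open import Level using (0ℓ)
open import Axiom.ExcludedMiddle using (ExcludedMiddle)
open import Data.Product using (_×_)
open import Data.Empty using (⊥; ⊥-elim)
open import Data.Fin using (Fin; zero; suc; toℕ; cast; join; splitAt)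
open import Data.Fin.Properties using (toℕ-cast; splitAt-join)
open import Data.List using (List; []; _∷_; _++_; map; concat; concatMap; length; lookup; tabulate;
  upTo; allFin; cartesianProductWith)
open import Data.List.Membership.Propositional using (_∈_; _∉_; find)
open import Data.List.Membership.Propositional.Properties
  using (∈-++⁺ˡ; ∈-++⁺ʳ; ∈-++⁻; ∈-map⁺; ∈-concat⁺′; ∈-cartesianProductWith⁺; ∈-upTo⁺; ∈-allFin)
open import Data.List.Properties using (map-tabulate; tabulate-cong; tabulate-lookup; length-tabulate)
open import Data.List.Relation.Binary.Subset.Propositional using (_⊆_)
open import Data.List.Relation.Unary.All as All using (All; []; _∷_)
open import Data.List.Relation.Unary.Any using (Any; here; there)
open import Data.Nat using (ℕ; zero; suc; _+_; _≤_; _<_; _⊔_; _≟_; s≤s; _≤′_; ≤′-refl; ≤′-step)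
import Data.Nat.Properties as ℕₚ
open import Data.Product using (Σ; ∃; _,_; proj₁; proj₂)
open import Data.Sum as Sum using (_⊎_; inj₁; inj₂; [_,_]; [_,_]′)
open import Data.Unit using (⊤; tt)
open import Data.Vec as Vec using (Vec; []; _∷_)
open import Data.Vec.Properties using (tabulate∘lookup)
open import Function using (_∘_; id)
open import Relation.Binary.PropositionalEquality as Eq
  using (_≡_; _≢_; refl; sym; trans; cong; cong₂)
open import Relation.Nullary using (¬_; Dec; yes; no; recompute)

-- The global trace condition does not compose, so every node of a proof graph carries a rank, a
-- height and one traced formula. An ordinary inference is ranked above everything built before it,
-- so all its edges lower the rank; the four nodes of a cycle share a rank, and only their exits
-- lower it. An infinite path thus ends up in a single cycle, and nested inductions need no
-- bookkeeping between their cycles.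
--
-- On the semantic side the signature is arbitrary, so its formulas cannot be enumerated. The theory
-- T decides only formulas over the symbols of the sequent, yet a Henkin structure owes a set to
-- every formula of the full language. Hence all other symbols receive a fixed interpretation and
-- are translated away before T is consulted. Equality must be identity in the model, so an element
-- is the first term of its class in a fixed enumeration. Excluded middle settles the ranks along a
-- path, decides each formula by provability of a sequent, and picks the representatives.

module Substitution (L : Signature) where
  open Signature L

  -- Simultaneous substitution in locally nameless syntax.

  mutual
    subT-cong : ∀ {m n} {θ θ' : ℕ → Term L n} {σ σ' : Fin m → Term L n} (t : Term L m) →
      (∀ {x} → x ∈ fvT L t → θ x ≡ θ' x) → (∀ i → σ i ≡ σ' i) →
      subT L θ σ t ≡ subT L θ' σ' t
    subT-cong (var x)    eθ eσ = eθ (here refl)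
    subT-cong (bvar i)   eθ eσ = eσ i
    subT-cong (app f ts) eθ eσ = cong (app f) (subTs-cong ts eθ eσ)

    subTs-cong : ∀ {m n k} {θ θ' : ℕ → Term L n} {σ σ' : Fin m → Term L n}
      (ts : Vec (Term L m) k) →
      (∀ {x} → x ∈ fvTs L ts → θ x ≡ θ' x) → (∀ i → σ i ≡ σ' i) →
      subTs L θ σ ts ≡ subTs L θ' σ' ts
    subTs-cong []       eθ eσ = refl
    subTs-cong (t ∷ ts) eθ eσ =
      cong₂ _∷_ (subT-cong t (eθ ∘ ∈-++⁺ˡ) eσ) (subTs-cong ts (eθ ∘ ∈-++⁺ʳ (fvT L t)) eσ)

  liftS-cong : ∀ {m n} {σ σ' : Fin m → Term L n} → (∀ i → σ i ≡ σ' i) →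
    ∀ i → liftS L σ i ≡ liftS L σ' i
  liftS-cong e zero    = refl
  liftS-cong e (suc i) = cong (weaken L) (e i)

  -- Agreement is asked only on the names that occur, which is what turns freshness of a name into
  -- invariance of the formula in `subF-fresh`.
  subF-cong : ∀ {m n} {θ θ' : ℕ → Term L n} {σ σ' : Fin m → Term L n} (φ : Form L m) →
    (∀ {x} → x ∈ fvF L φ → θ x ≡ θ' x) → (∀ i → σ i ≡ σ' i) →
    subF L θ σ φ ≡ subF L θ' σ' φ
  subF-cong (atom P ts) eθ eσ = cong (atom P) (subTs-cong ts eθ eσ)
  subF-cong (s ≐ t)     eθ eσ =
    cong₂ _≐_ (subT-cong s (eθ ∘ ∈-++⁺ˡ) eσ) (subT-cong t (eθ ∘ ∈-++⁺ʳ (fvT L s)) eσ)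
  subF-cong (¬' φ)      eθ eσ = cong ¬'_ (subF-cong φ eθ eσ)
  subF-cong (φ ∧' ψ)    eθ eσ =
    cong₂ _∧'_ (subF-cong φ (eθ ∘ ∈-++⁺ˡ) eσ) (subF-cong ψ (eθ ∘ ∈-++⁺ʳ (fvF L φ)) eσ)
  subF-cong (φ ∨' ψ)    eθ eσ =
    cong₂ _∨'_ (subF-cong φ (eθ ∘ ∈-++⁺ˡ) eσ) (subF-cong ψ (eθ ∘ ∈-++⁺ʳ (fvF L φ)) eσ)
  subF-cong (φ ⇒' ψ)    eθ eσ =
    cong₂ _⇒'_ (subF-cong φ (eθ ∘ ∈-++⁺ˡ) eσ) (subF-cong ψ (eθ ∘ ∈-++⁺ʳ (fvF L φ)) eσ)
  subF-cong (∀' φ)      eθ eσ =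
    cong ∀'_ (subF-cong φ (cong (weaken L) ∘ eθ) (liftS-cong eσ))
  subF-cong (∃' φ)      eθ eσ =
    cong ∃'_ (subF-cong φ (cong (weaken L) ∘ eθ) (liftS-cong eσ))
  subF-cong (rtc φ s t) eθ eσ
    rewrite subF-cong φ (cong (weaken L) ∘ cong (weaken L) ∘ eθ ∘ ∈-++⁺ˡ) (liftS-cong (liftS-cong eσ))
          | subT-cong s (eθ ∘ ∈-++⁺ʳ (fvF L φ) ∘ ∈-++⁺ˡ) eσ
          | subT-cong t (eθ ∘ ∈-++⁺ʳ (fvF L φ) ∘ ∈-++⁺ʳ (fvT L s)) eσ = refl

  mutual
    sub-renT : ∀ {k m n} (θ : ℕ → Term L n) (σ : Fin m → Term L n) (ρ : Fin k → Fin m) t →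
      subT L θ σ (renT L ρ t) ≡ subT L θ (σ ∘ ρ) t
    sub-renT θ σ ρ (var x)    = refl
    sub-renT θ σ ρ (bvar i)   = refl
    sub-renT θ σ ρ (app f ts) = cong (app f) (sub-renTs θ σ ρ ts)

    sub-renTs : ∀ {k m n l} (θ : ℕ → Term L n) (σ : Fin m → Term L n) (ρ : Fin k → Fin m)
      (ts : Vec (Term L k) l) →
      subTs L θ σ (renTs L ρ ts) ≡ subTs L θ (σ ∘ ρ) ts
    sub-renTs θ σ ρ []       = refl
    sub-renTs θ σ ρ (t ∷ ts) = cong₂ _∷_ (sub-renT θ σ ρ t) (sub-renTs θ σ ρ ts)

  mutual
    ren-subT : ∀ {k m n} (ρ : Fin m → Fin n) (θ : ℕ → Term L m) (σ : Fin k → Term L m) t →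
      renT L ρ (subT L θ σ t) ≡ subT L (renT L ρ ∘ θ) (renT L ρ ∘ σ) t
    ren-subT ρ θ σ (var x)    = refl
    ren-subT ρ θ σ (bvar i)   = refl
    ren-subT ρ θ σ (app f ts) = cong (app f) (ren-subTs ρ θ σ ts)

    ren-subTs : ∀ {k m n l} (ρ : Fin m → Fin n) (θ : ℕ → Term L m) (σ : Fin k → Term L m)
      (ts : Vec (Term L k) l) →
      renTs L ρ (subTs L θ σ ts) ≡ subTs L (renT L ρ ∘ θ) (renT L ρ ∘ σ) ts
    ren-subTs ρ θ σ []       = refl
    ren-subTs ρ θ σ (t ∷ ts) = cong₂ _∷_ (ren-subT ρ θ σ t) (ren-subTs ρ θ σ ts)

  sub-weaken : ∀ {m n} (θ : ℕ → Term L n) (σ : Fin m → Term L n) t →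
    subT L (wkS L θ) (liftS L σ) (weaken L t) ≡ weaken L (subT L θ σ t)
  sub-weaken θ σ t = trans (sub-renT _ _ suc t) (sym (ren-subT suc θ σ t))

  mutual
    subT-subT : ∀ {k m n} (θ' : ℕ → Term L n) (σ' : Fin m → Term L n)
      (θ : ℕ → Term L m) (σ : Fin k → Term L m) t →
      subT L θ' σ' (subT L θ σ t) ≡ subT L (subT L θ' σ' ∘ θ) (subT L θ' σ' ∘ σ) t
    subT-subT θ' σ' θ σ (var x)    = refl
    subT-subT θ' σ' θ σ (bvar i)   = refl
    subT-subT θ' σ' θ σ (app f ts) = cong (app f) (subTs-subTs θ' σ' θ σ ts)

    subTs-subTs : ∀ {k m n l} (θ' : ℕ → Term L n) (σ' : Fin m → Term L n)
      (θ : ℕ → Term L m) (σ : Fin k → Term L m) (ts : Vec (Term L k) l) →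
      subTs L θ' σ' (subTs L θ σ ts) ≡ subTs L (subT L θ' σ' ∘ θ) (subT L θ' σ' ∘ σ) ts
    subTs-subTs θ' σ' θ σ []       = refl
    subTs-subTs θ' σ' θ σ (t ∷ ts) = cong₂ _∷_ (subT-subT θ' σ' θ σ t) (subTs-subTs θ' σ' θ σ ts)

  sub-liftS : ∀ {k m n} (θ' : ℕ → Term L n) (σ' : Fin m → Term L n) (σ : Fin k → Term L m) i →
    subT L (wkS L θ') (liftS L σ') (liftS L σ i) ≡ liftS L (subT L θ' σ' ∘ σ) i
  sub-liftS θ' σ' σ zero    = refl
  sub-liftS θ' σ' σ (suc i) = sub-weaken θ' σ' (σ i)

  mutual
    subF-subF : ∀ {k m n} (θ' : ℕ → Term L n) (σ' : Fin m → Term L n)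
      (θ : ℕ → Term L m) (σ : Fin k → Term L m) φ →
      subF L θ' σ' (subF L θ σ φ) ≡ subF L (subT L θ' σ' ∘ θ) (subT L θ' σ' ∘ σ) φ
    subF-subF θ' σ' θ σ (atom P ts) = cong (atom P) (subTs-subTs θ' σ' θ σ ts)
    subF-subF θ' σ' θ σ (s ≐ t)     = cong₂ _≐_ (subT-subT θ' σ' θ σ s) (subT-subT θ' σ' θ σ t)
    subF-subF θ' σ' θ σ (¬' φ)      = cong ¬'_ (subF-subF θ' σ' θ σ φ)
    subF-subF θ' σ' θ σ (φ ∧' ψ)    = cong₂ _∧'_ (subF-subF θ' σ' θ σ φ) (subF-subF θ' σ' θ σ ψ)
    subF-subF θ' σ' θ σ (φ ∨' ψ)    = cong₂ _∨'_ (subF-subF θ' σ' θ σ φ) (subF-subF θ' σ' θ σ ψ)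
    subF-subF θ' σ' θ σ (φ ⇒' ψ)    = cong₂ _⇒'_ (subF-subF θ' σ' θ σ φ) (subF-subF θ' σ' θ σ ψ)
    subF-subF θ' σ' θ σ (∀' φ)      = cong ∀'_ (subF-subF↑ θ' σ' θ σ φ)
    subF-subF θ' σ' θ σ (∃' φ)      = cong ∃'_ (subF-subF↑ θ' σ' θ σ φ)
    subF-subF θ' σ' θ σ (rtc φ s t)
      rewrite subT-subT θ' σ' θ σ s | subT-subT θ' σ' θ σ t =
      cong (λ χ → rtc χ _ _)
        (trans (subF-subF↑ (wkS L θ') (liftS L σ') (wkS L θ) (liftS L σ) φ)
               (subF-cong φ (λ {x} _ → cong (weaken L) (sub-weaken θ' σ' (θ x)))
                            (liftS-cong (sub-liftS θ' σ' σ))))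

    subF-subF↑ : ∀ {k m n} (θ' : ℕ → Term L n) (σ' : Fin m → Term L n)
      (θ : ℕ → Term L m) (σ : Fin k → Term L m) φ →
      subF L (wkS L θ') (liftS L σ') (subF L (wkS L θ) (liftS L σ) φ) ≡
      subF L (wkS L (subT L θ' σ' ∘ θ)) (liftS L (subT L θ' σ' ∘ σ)) φ
    subF-subF↑ θ' σ' θ σ φ =
      trans (subF-subF (wkS L θ') (liftS L σ') (wkS L θ) (liftS L σ) φ)
            (subF-cong φ (λ {x} _ → sub-weaken θ' σ' (θ x)) (sub-liftS θ' σ' σ))

  mutual
    subT-id : ∀ {n} (t : Term L n) → subT L var bvar t ≡ t
    subT-id (var x)    = refl
    subT-id (bvar i)   = refl
    subT-id (app f ts) = cong (app f) (subTs-id ts)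

    subTs-id : ∀ {n k} (ts : Vec (Term L n) k) → subTs L var bvar ts ≡ ts
    subTs-id []       = refl
    subTs-id (t ∷ ts) = cong₂ _∷_ (subT-id t) (subTs-id ts)

  liftS-bvar : ∀ {n} (i : Fin (suc n)) → liftS L bvar i ≡ bvar i
  liftS-bvar zero    = refl
  liftS-bvar (suc i) = refl

  mutual
    subF-id : ∀ {n} (φ : Form L n) → subF L var bvar φ ≡ φ
    subF-id (atom P ts) = cong (atom P) (subTs-id ts)
    subF-id (s ≐ t)     = cong₂ _≐_ (subT-id s) (subT-id t)
    subF-id (¬' φ)      = cong ¬'_ (subF-id φ)
    subF-id (φ ∧' ψ)    = cong₂ _∧'_ (subF-id φ) (subF-id ψ)
    subF-id (φ ∨' ψ)    = cong₂ _∨'_ (subF-id φ) (subF-id ψ)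
    subF-id (φ ⇒' ψ)    = cong₂ _⇒'_ (subF-id φ) (subF-id ψ)
    subF-id (∀' φ)      = cong ∀'_ (subF-id↑ φ)
    subF-id (∃' φ)      = cong ∃'_ (subF-id↑ φ)
    subF-id (rtc φ s t) rewrite subT-id s | subT-id t =
      cong (λ χ → rtc χ s t)
        (trans (subF-cong φ (λ _ → refl)
                 (λ i → trans (liftS-cong liftS-bvar i) (liftS-bvar i)))
               (subF-id φ))

    subF-id↑ : ∀ {n} (φ : Form L (suc n)) → subF L (wkS L var) (liftS L bvar) φ ≡ φ
    subF-id↑ φ = trans (subF-cong φ (λ _ → refl) liftS-bvar) (subF-id φ)

  subT-fresh : ∀ {n} {θ : ℕ → Term L n} {σ : Fin n → Term L n} (t : Term L n) →
    (∀ {x} → x ∈ fvT L t → θ x ≡ var x) → (∀ i → σ i ≡ bvar i) → subT L θ σ t ≡ t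
  subT-fresh t eθ eσ = trans (subT-cong t eθ eσ) (subT-id t)

  subF-fresh : ∀ {n} {θ : ℕ → Term L n} {σ : Fin n → Term L n} (φ : Form L n) →
    (∀ {x} → x ∈ fvF L φ → θ x ≡ var x) → (∀ i → σ i ≡ bvar i) → subF L θ σ φ ≡ φ
  subF-fresh φ eθ eσ = trans (subF-cong φ eθ eσ) (subF-id φ)

  infixl 5 _▹_
  _▹_ : ∀ {A : Set} {m} → (Fin m → A) → A → Fin (suc m) → A
  (σ ▹ a) zero    = a
  (σ ▹ a) (suc i) = σ i

  inst-weaken : ∀ {n} {t : Term L n} u → subT L var (σ₁ L t) (weaken L u) ≡ u
  inst-weaken u = trans (sub-renT _ _ suc u) (subT-id u)

  inst-weaken² : ∀ {n} {a b : Term L n} u → subT L var (σ₂ L a b) (weaken L (weaken L u)) ≡ u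
  inst-weaken² u =
    trans (sub-renT _ _ suc (weaken L u)) (trans (sub-renT _ _ suc u) (subT-id u))

  -- Instantiation undoes the weakening performed by `wkS` and `liftS`, so it is absorbed into the
  -- environment `σ ▹ t`. The truth lemma can therefore recurse on the body of a quantifier instead
  -- of on its instances.
  inst1-lift : ∀ {m n} (θ : ℕ → Term L n) (σ : Fin m → Term L n) φ t →
    inst1 L (subF L (wkS L θ) (liftS L σ) φ) t ≡ subF L θ (σ ▹ t) φ
  inst1-lift θ σ φ t = trans (subF-subF _ _ _ _ φ)
    (subF-cong φ (λ {x} _ → inst-weaken (θ x))
      λ { zero → refl ; (suc i) → inst-weaken (σ i) })

  inst2-lift : ∀ {m n} (θ : ℕ → Term L n) (σ : Fin m → Term L n) φ a b →
    inst2 L (subF L (wkS L (wkS L θ)) (liftS L (liftS L σ)) φ) a b ≡ subF L θ (σ ▹ b ▹ a) φ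
  inst2-lift θ σ φ a b = trans (subF-subF _ _ _ _ φ)
    (subF-cong φ (λ {x} _ → inst-weaken² (θ x))
      λ { zero → refl ; (suc zero) → refl ; (suc (suc i)) → inst-weaken² (σ i) })

  -- Fresh names and substitutions that move a single name.

  fresh : List ℕ → ℕ
  fresh []       = 0
  fresh (x ∷ xs) = suc x ⊔ fresh xs

  <-fresh : ∀ {x} xs → x ∈ xs → x < fresh xs
  <-fresh (y ∷ xs) (here refl) = ℕₚ.m≤m⊔n (suc y) (fresh xs)
  <-fresh (y ∷ xs) (there p)   = ℕₚ.≤-trans (<-fresh xs p) (ℕₚ.m≤n⊔m (suc y) (fresh xs))

  fresh-∉ : ∀ xs → fresh xs ∉ xs
  fresh-∉ xs p = ℕₚ.<-irrefl refl (<-fresh xs p)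

  fresh-for : (xss : List (List ℕ)) → Σ ℕ λ z → All (z ∉_) xss
  fresh-for xss = fresh (concat xss) , go xss (fresh-∉ (concat xss))
    where
    go : ∀ {z} xss → z ∉ concat xss → All (z ∉_) xss
    go []         z∉ = []
    go (xs ∷ xss) z∉ = z∉ ∘ ∈-++⁺ˡ ∷ go xss (z∉ ∘ ∈-++⁺ʳ xs)

  infixl 5 _[_↦_]
  _[_↦_] : (ℕ → Term L 0) → ℕ → Term L 0 → ℕ → Term L 0
  (θ [ z ↦ t ]) x with x ≟ z
  ... | yes _ = t
  ... | no  _ = θ x

  ↦-this : ∀ θ z t → (θ [ z ↦ t ]) z ≡ t
  ↦-this θ z t with z ≟ z
  ... | yes _  = refl
  ... | no z≢z = ⊥-elim (z≢z refl)

  ↦-other : ∀ θ {z x} t → x ≢ z → (θ [ z ↦ t ]) x ≡ θ x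
  ↦-other θ {z} {x} t x≢z with x ≟ z
  ... | yes e = ⊥-elim (x≢z e)
  ... | no  _ = refl

  infix 4 _fixes_
  _fixes_ : (ℕ → Term L 0) → List ℕ → Set
  θ fixes xs = ∀ {x} → x ∈ xs → θ x ≡ var x

  ↦-fixes : ∀ {θ z t xs} → z ∉ xs → θ fixes xs → θ [ z ↦ t ] fixes xs
  ↦-fixes {θ} {t = t} z∉ fix x∈ =
    trans (↦-other θ t λ { refl → z∉ x∈ }) (fix x∈)

  wkS-fixed : ∀ {n} {t : Term L n} {x} → t ≡ var x → weaken L t ≡ var x
  wkS-fixed refl = refl

  substF-inst1 : ∀ {θ} (ψ : Form L 1) u → θ fixes fvF L ψ →
    substF L θ (inst1 L ψ u) ≡ inst1 L ψ (subT L θ bvar u)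
  substF-inst1 ψ u fix = trans (subF-subF _ _ _ _ ψ)
    (subF-cong ψ fix λ { zero → refl })

  substF-inst2 : ∀ {θ} (φ : Form L 2) u v → θ fixes fvF L φ →
    substF L θ (inst2 L φ u v) ≡ inst2 L φ (subT L θ bvar u) (subT L θ bvar v)
  substF-inst2 φ u v fix = trans (subF-subF _ _ _ _ φ)
    (subF-cong φ fix λ { zero → refl ; (suc zero) → refl })

  substF-rtc : ∀ {θ} (φ : Form L 2) s t → θ fixes fvF L φ → θ fixes fvT L s →
    substF L θ (rtc φ s t) ≡ rtc φ s (subT L θ bvar t)
  substF-rtc φ s t fixφ fixs = cong₂ (λ χ s → rtc χ s _)
    (subF-fresh φ (λ x∈ → wkS-fixed (wkS-fixed (fixφ x∈)))
      λ { zero → refl ; (suc zero) → refl })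
    (subT-fresh s fixs (λ ()))

  map-substF-fresh : ∀ {θ} Γ → θ fixes fvL L Γ → map (substF L θ) Γ ≡ Γ
  map-substF-fresh []      fix = refl
  map-substF-fresh (φ ∷ Γ) fix = cong₂ _∷_
    (subF-fresh φ (fix ∘ ∈-++⁺ˡ) (λ ()))
    (map-substF-fresh Γ (fix ∘ ∈-++⁺ʳ (fvF L φ)))

-- Proof graphs with a local trace condition.

module CyclicProofs (em : ExcludedMiddle 0ℓ) (L : Signature) where
  open Substitution L

  -- `Node` is an arbitrary type, so that gluing graphs is a disjoint sum. A retraction onto `Node`
  -- is enough for finiteness: every index, in the image of `enc` or not, decodes to a node and
  -- inherits its rule. The traced formula depends on the node alone, never on the path that reached
  -- it.
  record Graph : Set₁ where
    field
      Node    : Set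
      size    : ℕ
      enc     : Node → Fin size
      dec     : Fin size → Node
      dec-enc : ∀ i → dec (enc i) ≡ i
      seq     : Node → Sequent L
      prem    : Node → List (Sequent L)
      rule    : ∀ i → CRule L (seq i) (prem i)
      child   : ∀ i → Fin (length (prem i)) → Node
      child-seq : ∀ i k → seq (child i k) ≡ lookup (prem i) k
      rank ht : Node → ℕ
      bound   : ℕ
      rank<   : ∀ i → rank i < bound
      trace   : Node → Form L 0

    -- A local condition implying the global trace condition: rank is constant from
    -- some point of a path on, and then ht allows no infinite run without progress.
    Edge : ∀ i → Fin (length (prem i)) → Node → Set
    Edge i k j = rank j < rank i ⊎ (rank j ≡ rank i ×
      ((TP L (rule i) (toℕ k) (lookup (prem i) k) (trace i) (trace j) × ht j < ht i)
       ⊎ Prog L (rule i) (toℕ k) (trace i) (trace j)))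

    field
      edge : ∀ i k → Edge i k (child i k)

  -- Recursion on a bound `n` for `r m`: excluded middle tells whether a strict drop still lies
  -- ahead, and each drop lowers the bound.
  settle : (r : ℕ → ℕ) → (∀ k → r (suc k) ≤ r k) →
    ∃ λ m → ∀ k → m ≤ k → r (suc k) ≡ r k
  settle r dec = go (r 0) 0 ℕₚ.≤-refl
    where
    go : ∀ n m → r m ≤ n → ∃ λ m → ∀ k → m ≤ k → r (suc k) ≡ r k
    go n m r≤n with em {Σ ℕ λ k → m ≤ k × r (suc k) < r k}
    ... | no ¬p = m , λ k m≤k → ℕₚ.≤∧≮⇒≡ (dec k) (λ lt → ¬p (k , m≤k , lt))
    ... | yes (k , m≤k , lt) = drop n (ℕₚ.<-≤-trans lt (ℕₚ.≤-trans (mono m≤k) r≤n))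
      where
      mono′ : ∀ {k} → m ≤′ k → r k ≤ r m
      mono′ ≤′-refl     = ℕₚ.≤-refl
      mono′ (≤′-step p) = ℕₚ.≤-trans (dec _) (mono′ p)
      mono : ∀ {k} → m ≤ k → r k ≤ r m
      mono m≤k = mono′ (ℕₚ.≤⇒≤′ m≤k)
      drop : ∀ n → r (suc k) < n → ∃ λ m → ∀ k → m ≤ k → r (suc k) ≡ r k
      drop (suc n) (s≤s r≤n) = go n (suc k) r≤n

  module _ (G : Graph) where
    open Graph G

    -- The trace is the labelling of the nodes, followed from where the rank has settled. From there
    -- every step progresses or lowers `ht`, so the height of the current node bounds the wait for
    -- the next progress.
    path-trace : (p : ℕ → Node) (d : ∀ k → Fin (length (prem (p k)))) →
      (∀ k → p (suc k) ≡ child (p k) (d k)) →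
      ∃ λ m →
        (∀ k → m ≤ k →
            TP L (rule (p k)) (toℕ (d k)) (seq (p (suc k))) (trace (p k)) (trace (p (suc k)))
          ⊎ Prog L (rule (p k)) (toℕ (d k)) (trace (p k)) (trace (p (suc k)))) ×
        (∀ j → Σ ℕ λ k → j ≤ k × m ≤ k ×
            Prog L (rule (p k)) (toℕ (d k)) (trace (p k)) (trace (p (suc k))))
    path-trace p d step = m , pairs , λ j →
      let k , j⊔m≤k , pr = prog _ (j ⊔ m) (ℕₚ.m≤n⊔m j m) ℕₚ.≤-refl
      in  k , ℕₚ.≤-trans (ℕₚ.m≤m⊔n j m) j⊔m≤k , ℕₚ.≤-trans (ℕₚ.m≤n⊔m j m) j⊔m≤k , pr
      where
      edge′ : ∀ k → Edge (p k) (d k) (p (suc k))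
      edge′ k rewrite step k = edge (p k) (d k)

      prem≡ : ∀ k → lookup (prem (p k)) (d k) ≡ seq (p (suc k))
      prem≡ k rewrite step k = sym (child-seq (p k) (d k))

      antitone : ∀ k → rank (p (suc k)) ≤ rank (p k)
      antitone k with edge′ k
      ... | inj₁ lt       = ℕₚ.<⇒≤ lt
      ... | inj₂ (eq , _) = ℕₚ.≤-reflexive eq

      settled = settle (rank ∘ p) antitone
      m = proj₁ settled

      flat : ∀ k → m ≤ k →
        (TP L (rule (p k)) (toℕ (d k)) (seq (p (suc k))) (trace (p k)) (trace (p (suc k)))
          × ht (p (suc k)) < ht (p k))
        ⊎ Prog L (rule (p k)) (toℕ (d k)) (trace (p k)) (trace (p (suc k)))
      flat k m≤k with edge′ k
      ... | inj₁ lt = ⊥-elim (ℕₚ.<-irrefl (proj₂ settled k m≤k) lt)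
      ... | inj₂ (_ , inj₂ pr) = inj₂ pr
      ... | inj₂ (_ , inj₁ (tp , lt)) =
        inj₁ (Eq.subst (λ P → TP L (rule (p k)) (toℕ (d k)) P _ _) (prem≡ k) tp , lt)

      pairs : ∀ k → m ≤ k → _
      pairs k m≤k with flat k m≤k
      ... | inj₁ (tp , _) = inj₁ tp
      ... | inj₂ pr       = inj₂ pr

      prog : ∀ n k → m ≤ k → ht (p k) ≤ n → Σ ℕ λ k' → k ≤ k' ×
        Prog L (rule (p k')) (toℕ (d k')) (trace (p k')) (trace (p (suc k')))
      prog n k m≤k h≤n with flat k m≤k
      ... | inj₂ pr       = k , ℕₚ.≤-refl , pr
      ... | inj₁ (_ , lt) = descend n (ℕₚ.<-≤-trans lt h≤n)
        where
        descend : ∀ n → ht (p (suc k)) < n → _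
        descend (suc n) (s≤s h≤n) =
          let k' , k<k' , pr = prog n (suc k) (ℕₚ.m≤n⇒m≤1+n m≤k) h≤n
          in  k' , ℕₚ.<⇒≤ k<k' , pr

  -- The list of child sequents in a `PreProof` equals the premises of the rule only
  -- propositionally, so the rule has to be transported; the trace relations survive this because
  -- they never inspect the premise list.
  TP-subst : ∀ {C Ps Qs} (e : Ps ≡ Qs) (r : CRule L C Ps) {k P τ τ'} →
    TP L r k P τ τ' → TP L (Eq.subst (CRule L C) e r) k P τ τ'
  TP-subst refl r tp = tp

  Prog-subst : ∀ {C Ps Qs} (e : Ps ≡ Qs) (r : CRule L C Ps) {k τ τ'} →
    Prog L r k τ τ' → Prog L (Eq.subst (CRule L C) e r) k τ τ'
  Prog-subst refl r pr = pr

  tabulate-at : ∀ {A : Set} {n} (f : Fin n → A) (i : Fin (length (tabulate f))) →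
    lookup (tabulate f) i ≡ f (cast (length-tabulate f) i)
  tabulate-at {n = suc n} f zero    = refl
  tabulate-at {n = suc n} f (suc i) = tabulate-at (f ∘ suc) i

  module _ (G : Graph) (root : Graph.Node G) where
    open Graph G

    children : Fin size → List (Fin size)
    children i = tabulate (enc ∘ child (dec i))

    children-seq : ∀ i → prem (dec i) ≡ map (seq ∘ dec) (children i)
    children-seq i = sym (trans (map-tabulate (enc ∘ child (dec i)) (seq ∘ dec))
      (trans (tabulate-cong λ k → trans (cong seq (dec-enc _)) (child-seq (dec i) k))
             (tabulate-lookup (prem (dec i)))))

    unfold : PreProof L (seq root)
    unfold = record
      { size   = size
      ; seqAt  = seq ∘ dec
      ; root   = enc root
      ; rootOK = cong seq (dec-enc root)
      ; prems  = children
      ; ruleAt = λ i → Eq.subst (CRule L _) (children-seq i) (rule (dec i))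
      }

    unfold-good : (p : Path L unfold) → GoodTrace L unfold p
    unfold-good p = m , trace ∘ dec ∘ node , pairs , inf
      where
      open Path p
      d : ∀ k → Fin (length (prem (dec (node k))))
      d k = cast (length-tabulate (enc ∘ child (dec (node k)))) (dir k)

      step′ : ∀ k → dec (node (suc k)) ≡ child (dec (node k)) (d k)
      step′ k = trans (cong dec (trans (step k) (tabulate-at (enc ∘ child (dec (node k))) (dir k))))
                      (dec-enc _)

      good = path-trace G (dec ∘ node) d step′
      m = proj₁ good

      toℕ-d : ∀ k → toℕ (d k) ≡ toℕ (dir k)
      toℕ-d k = toℕ-cast _ (dir k)

      prog′ : ∀ k {τ τ'} → Prog L (rule (dec (node k))) (toℕ (d k)) τ τ' →
        Prog L (PreProof.ruleAt unfold (node k)) (toℕ (dir k)) τ τ'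
      prog′ k pr = Prog-subst (children-seq (node k)) (rule (dec (node k)))
        (Eq.subst (λ x → Prog L (rule (dec (node k))) x _ _) (toℕ-d k) pr)

      pairs : ∀ k → m ≤ k →
          TP L (PreProof.ruleAt unfold (node k)) (toℕ (dir k)) (seq (dec (node (suc k))))
             (trace (dec (node k))) (trace (dec (node (suc k))))
        ⊎ Prog L (PreProof.ruleAt unfold (node k)) (toℕ (dir k))
             (trace (dec (node k))) (trace (dec (node (suc k))))
      pairs k m≤k with proj₁ (proj₂ good) k m≤k
      ... | inj₁ tp = inj₁ (TP-subst (children-seq (node k)) (rule (dec (node k))) {toℕ (dir k)}
              (Eq.subst (λ x → TP L (rule (dec (node k))) x _ _ _) (toℕ-d k) tp))
      ... | inj₂ pr = inj₂ (prog′ k pr)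

      inf : ∀ j → Σ ℕ λ k → j ≤ k × m ≤ k × _
      inf j = let k , j≤k , m≤k , pr = proj₂ (proj₂ good) j in k , j≤k , m≤k , prog′ k pr

  -- New nodes on top of `G`: their children may lie in `G` or in the block, while no edge leads
  -- from `G` into the block. Cycles can thus arise only inside one block, where rank and height are
  -- chosen together.
  record Block (G : Graph) : Set₁ where
    open Graph G using () renaming (Node to Old; seq to seqᵒ; rank to rankᵒ; ht to htᵒ; trace to traceᵒ)
    field
      Node    : Set
      size    : ℕ
      enc     : Node → Fin size
      dec     : Fin size → Node
      dec-enc : ∀ i → dec (enc i) ≡ i
      seq     : Node → Sequent L
      prem    : Node → List (Sequent L)
      rule    : ∀ i → CRule L (seq i) (prem i)
      child   : ∀ i → Fin (length (prem i)) → Old ⊎ Node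
      child-seq : ∀ i k → [ seqᵒ , seq ]′ (child i k) ≡ lookup (prem i) k
      rank ht : Node → ℕ
      bound   : ℕ
      rank<   : ∀ i → rank i < bound
      trace   : Node → Form L 0

    Edge : ∀ i → Fin (length (prem i)) → Old ⊎ Node → Set
    Edge i k j = [ rankᵒ , rank ]′ j < rank i ⊎ ([ rankᵒ , rank ]′ j ≡ rank i ×
      ((TP L (rule i) (toℕ k) (lookup (prem i) k) (trace i) ([ traceᵒ , trace ]′ j)
          × [ htᵒ , ht ]′ j < ht i)
       ⊎ Prog L (rule i) (toℕ k) (trace i) ([ traceᵒ , trace ]′ j)))

    field
      edge : ∀ i k → Edge i k (child i k)

  extend : (G : Graph) → Block G → Graph
  extend G B = record
    { Node      = G.Node ⊎ B.Node
    ; size      = G.size + B.size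
    ; enc       = join G.size B.size ∘ Sum.map G.enc B.enc
    ; dec       = Sum.map G.dec B.dec ∘ splitAt G.size
    ; dec-enc   = λ i → trans (cong (Sum.map G.dec B.dec) (splitAt-join G.size B.size (Sum.map G.enc B.enc i))) (retract i)
    ; seq       = [ G.seq , B.seq ]′
    ; prem      = [ G.prem , B.prem ]′
    ; rule      = [ G.rule , B.rule ]
    ; child     = λ { (inj₁ i) k → inj₁ (G.child i k) ; (inj₂ i) k → B.child i k }
    ; child-seq = [ G.child-seq , B.child-seq ]
    ; rank      = [ G.rank , B.rank ]′
    ; ht        = [ G.ht , B.ht ]′
    ; bound     = G.bound ⊔ B.bound
    ; rank<     = [ (λ i → ℕₚ.<-≤-trans (G.rank< i) (ℕₚ.m≤m⊔n G.bound B.bound))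
                  , (λ i → ℕₚ.<-≤-trans (B.rank< i) (ℕₚ.m≤n⊔m G.bound B.bound)) ]
    ; trace     = [ G.trace , B.trace ]′
    ; edge      = λ { (inj₁ i) k → G.edge i k ; (inj₂ i) k → B.edge i k }
    }
    where
    module G = Graph G
    module B = Block B
    retract : ∀ i → Sum.map G.dec B.dec (Sum.map G.enc B.enc i) ≡ i
    retract (inj₁ i) = cong inj₁ (G.dec-enc i)
    retract (inj₂ i) = cong inj₂ (B.dec-enc i)

  _⊕_ : Graph → Graph → Graph
  G ⊕ H = extend G record
    { H
    ; child = λ i k → inj₂ (H.child i k)
    }
    where module H = Graph H

  _∋_ : Graph → Sequent L → Set
  G ∋ S = Σ (Graph.Node G) λ i → Graph.seq G i ≡ S

  -- One graph holds all the sequents, since a rule with several premises must find its children in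
  -- a single graph.
  Cyclic : List (Sequent L) → Set₁
  Cyclic Ss = Σ Graph λ G → All (G ∋_) Ss

  empty : Cyclic []
  empty = record
    { Node = ⊥ ; size = 0 ; enc = λ () ; dec = λ () ; dec-enc = λ ()
    ; seq = λ () ; prem = λ () ; rule = λ () ; child = λ () ; child-seq = λ ()
    ; rank = λ () ; ht = λ () ; bound = 0 ; rank< = λ () ; trace = λ () ; edge = λ () } , []

  _∷ᶜ_ : ∀ {S Ss} → Cyclic (S ∷ []) → Cyclic Ss → Cyclic (S ∷ Ss)
  (G , (i , e) ∷ []) ∷ᶜ (H , is) = G ⊕ H , (inj₁ i , e) ∷ All.map (λ (i , e) → inj₂ i , e) is

  lookup-root : ∀ {Ss} (G : Graph) → All (G ∋_) Ss → ∀ k → G ∋ lookup Ss k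
  lookup-root G (i ∷ is) zero    = i
  lookup-root G (i ∷ is) (suc k) = lookup-root G is k

  infer : ∀ {C Ps} → CRule L C Ps → Cyclic Ps → Cyclic (C ∷ [])
  infer {C} {Ps} r (G , is) = extend G record
    { Node = ⊤ ; size = 1 ; enc = λ _ → zero ; dec = λ _ → tt ; dec-enc = λ _ → refl
    ; seq = λ _ → C ; prem = λ _ → Ps ; rule = λ _ → r
    ; child = λ _ k → inj₁ (proj₁ (lookup-root G is k))
    ; child-seq = λ _ k → proj₂ (lookup-root G is k)
    -- The rank exceeds every rank in `G`, so each edge out of the new node lowers it; the traced
    -- formula is a mere placeholder.
    ; rank = λ _ → G.bound ; ht = λ _ → 0
    ; bound = suc G.bound ; rank< = λ _ → ℕₚ.≤-refl
    ; trace = λ _ → rtc (var 0 ≐ var 0) (var 0) (var 0)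
    ; edge = λ _ k → inj₁ (G.rank< (proj₁ (lookup-root G is k)))
    } , (inj₂ tt , refl) ∷ []
    where module G = Graph G

  -- The cycle that replaces an induction inference.

  data LoopNode : Set where
    caseⁿ cutⁿ wkⁿ substⁿ : LoopNode

  module _ {Γ Δ : List (Form L 0)} (φ : Form L 2) (s : Term L 0) (ψ : Form L 1) (z w : ℕ)
    (z∉Γ : z ∉ fvL L Γ) (z∉Δ : z ∉ fvL L Δ) (z∉φ : z ∉ fvF L φ) (z∉s : z ∉ fvT L s)
    (z∉ψ : z ∉ fvF L ψ)
    (w∉Γ : w ∉ fvL L Γ) (w∉Δ : w ∉ fvL L (inst1 L ψ (var z) ∷ Δ))
    (w∉rtc : w ∉ fvF L (rtc φ s (var z)))
    where

    private
      θ : ℕ → Term L 0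
      θ = var [ z ↦ var w ]

      fix : ∀ {xs} → z ∉ xs → θ fixes xs
      fix z∉ = ↦-fixes z∉ (λ _ → refl)

      rtc-θ : substF L θ (rtc φ s (var z)) ≡ rtc φ s (var w)
      rtc-θ = trans (substF-rtc φ s (var z) (fix z∉φ) (fix z∉s))
                    (cong (rtc φ s) (↦-this var z (var w)))

      ψ-θ : substF L θ (inst1 L ψ (var z)) ≡ inst1 L ψ (var w)
      ψ-θ = trans (substF-inst1 ψ (var z) (fix z∉ψ))
                  (cong (inst1 L ψ) (↦-this var z (var w)))

    -- The two inputs are the exits of the cycle: the base case, and the induction step from `w` to
    -- `z`. As `z` is fresh for `Γ`, `Δ`, `φ`, `s` and `ψ`, renaming it to `w` sends the root
    -- exactly to what remains of the cut premise once `φ(w,z)` and `ψ(z)` are weakened away.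
    loop :
      Cyclic (((s ≐ var z) ∷ Γ ⊢ inst1 L ψ (var z) ∷ Δ) ∷
              (inst1 L ψ (var w) ∷ rtc φ s (var w) ∷ inst2 L φ (var w) (var z) ∷ Γ
                 ⊢ inst1 L ψ (var z) ∷ Δ) ∷ []) →
      Cyclic ((rtc φ s (var z) ∷ Γ ⊢ inst1 L ψ (var z) ∷ Δ) ∷ [])
    loop (G , (base , base≡) ∷ (step , step≡) ∷ []) = extend G record
      { Node = LoopNode ; size = 4
      ; enc = λ { caseⁿ → zero ; cutⁿ → suc zero ; wkⁿ → suc (suc zero) ; substⁿ → suc (suc (suc zero)) }
      ; dec = λ { zero → caseⁿ ; (suc zero) → cutⁿ ; (suc (suc zero)) → wkⁿ ; (suc (suc (suc zero))) → substⁿ }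
      ; dec-enc = λ { caseⁿ → refl ; cutⁿ → refl ; wkⁿ → refl ; substⁿ → refl }
      ; seq = seq
      ; prem = prem
      ; rule = rule
      ; child = child
      ; child-seq = λ
          { caseⁿ  zero → base≡ ; caseⁿ (suc zero) → refl
          ; cutⁿ   zero → refl  ; cutⁿ  (suc zero) → step≡
          ; wkⁿ    zero → cong₂ _⊢_ (cong₂ _∷_ rtc-θ (map-substF-fresh Γ (fix z∉Γ)))
                                    (cong₂ _∷_ ψ-θ (map-substF-fresh Δ (fix z∉Δ)))
          ; substⁿ zero → refl }
      -- All four nodes share a rank above those of `G`. Heights fall 3, 2, 1, 0 from `cutⁿ` round
      -- to `caseⁿ`; the jump from 0 back to 3 happens on the progressing edge.
      ; rank = λ _ → G.bound
      ; ht = λ { caseⁿ → 0 ; cutⁿ → 3 ; wkⁿ → 2 ; substⁿ → 1 }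
      ; bound = suc G.bound ; rank< = λ _ → ℕₚ.≤-refl
      -- (Case) moves the target from `z` to `w`; read from conclusion to premise, (Subst) with
      -- `z ↦ w` moves it back to `z`.
      ; trace = λ { caseⁿ → rtc φ s (var z) ; _ → rtc φ s (var w) }
      ; edge = λ
          { caseⁿ  zero       → inj₁ (G.rank< base)
          ; caseⁿ  (suc zero) → inj₂ (refl , inj₂ (refl , refl , refl))
          ; cutⁿ   zero       → inj₂ (refl , inj₁ ((isRTC , here refl , here refl , refl) , ℕₚ.≤-refl))
          ; cutⁿ   (suc zero) → inj₁ (G.rank< step)
          ; wkⁿ    zero       → inj₂ (refl , inj₁ ((isRTC , here refl , here refl , refl) , ℕₚ.≤-refl))
          ; substⁿ zero       → inj₂ (refl , inj₁ ((isRTC , here refl , sym rtc-θ) , ℕₚ.≤-refl)) }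
      } , (inj₂ caseⁿ , refl) ∷ []
      where
      module G = Graph G
      seq : LoopNode → Sequent L
      seq caseⁿ  = rtc φ s (var z) ∷ Γ ⊢ inst1 L ψ (var z) ∷ Δ
      seq cutⁿ   = rtc φ s (var w) ∷ inst2 L φ (var w) (var z) ∷ Γ ⊢ inst1 L ψ (var z) ∷ Δ
      seq wkⁿ    = rtc φ s (var w) ∷ inst2 L φ (var w) (var z) ∷ Γ ⊢ inst1 L ψ (var w) ∷ inst1 L ψ (var z) ∷ Δ
      seq substⁿ = map (substF L θ) (rtc φ s (var z) ∷ Γ) ⊢ map (substF L θ) (inst1 L ψ (var z) ∷ Δ)

      prem : LoopNode → List (Sequent L)
      prem caseⁿ  = ((s ≐ var z) ∷ Γ ⊢ inst1 L ψ (var z) ∷ Δ) ∷ seq cutⁿ ∷ []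
      prem cutⁿ   = seq wkⁿ ∷ (inst1 L ψ (var w) ∷ ante (seq cutⁿ) ⊢ inst1 L ψ (var z) ∷ Δ) ∷ []
      prem wkⁿ    = (rtc φ s (var w) ∷ Γ ⊢ inst1 L ψ (var w) ∷ Δ) ∷ []
      prem substⁿ = seq caseⁿ ∷ []

      rule : ∀ i → CRule L (seq i) (prem i)
      rule caseⁿ  = case φ s (var z) w w∉Γ w∉Δ w∉rtc
      rule cutⁿ   = core (cut (inst1 L ψ (var w)))
      rule wkⁿ    = core (wk (λ { (here p) → here p ; (there p) → there (there p) })
                             (λ { (here p) → here p ; (there p) → there (there p) }))
      rule substⁿ = core (subst θ)

      child : ∀ i → Fin (length (prem i)) → G.Node ⊎ LoopNode
      child caseⁿ  zero       = inj₁ base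
      child caseⁿ  (suc zero) = inj₂ cutⁿ
      child cutⁿ   zero       = inj₂ wkⁿ
      child cutⁿ   (suc zero) = inj₁ step
      child wkⁿ    zero       = inj₂ substⁿ
      child substⁿ zero       = inj₂ caseⁿ

  infer-subst : ∀ {Γ Δ S} θ → (map (substF L θ) Γ ⊢ map (substF L θ) Δ) ≡ S →
    Cyclic ((Γ ⊢ Δ) ∷ []) → Cyclic (S ∷ [])
  infer-subst θ refl = infer (core (subst θ))

  -- The bud must be a substitution instance of the root, so the cycle is run with a name `z` as
  -- target, and `t` is put for `z` by one (Subst) below it. New names are chosen because `a` and
  -- `b` may occur in `s`.
  infer-ind : ∀ {S Ps} → GRule L S Ps → Cyclic Ps → Cyclic (S ∷ [])
  infer-ind (core r) π = infer (core r) π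
  infer-ind (ind {Γ} {Δ} ψ φ s t a b a≢b a∉Γ a∉Δ a∉ψ a∉φ b∉Γ b∉Δ b∉ψ b∉φ) π
    -- `ψ(s)` travels in the context of the cycle, since the exit `s = z` may be taken at any turn.
    with fresh-for (fvL L (inst1 L ψ s ∷ Γ) ∷ fvL L Δ ∷ fvF L φ ∷ fvT L s ∷ fvF L ψ ∷ [])
  ... | z , z∉Γ ∷ z∉Δ ∷ z∉φ ∷ z∉s ∷ z∉ψ ∷ []
    with fresh-for (fvL L (inst1 L ψ s ∷ Γ) ∷ fvL L (inst1 L ψ (var z) ∷ Δ) ∷ fvF L (rtc φ s (var z)) ∷ [])
  ... | w , w∉Γ ∷ w∉Δ ∷ w∉rtc ∷ [] =
    infer (core (wk (λ { (here p) → there (here p) ; (there (here p)) → here p ; (there (there p)) → there (there p) }) id))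
      (infer-subst (var [ z ↦ t ]) root≡
        (loop φ s ψ z w z∉Γ z∉Δ z∉φ z∉s z∉ψ w∉Γ w∉Δ w∉rtc (base ∷ᶜ step)))
    where
    fix : ∀ {xs} → z ∉ xs → var [ z ↦ t ] fixes xs
    fix z∉ = ↦-fixes z∉ (λ _ → refl)

    root≡ : _ ≡ (rtc φ s t ∷ inst1 L ψ s ∷ Γ ⊢ inst1 L ψ t ∷ Δ)
    root≡ = cong₂ _⊢_
      (cong₂ _∷_ (trans (substF-rtc φ s (var z) (fix z∉φ) (fix z∉s))
                        (cong (rtc φ s) (↦-this var z t)))
                 (map-substF-fresh (inst1 L ψ s ∷ Γ) (fix z∉Γ)))
      (cong₂ _∷_ (trans (substF-inst1 ψ (var z) (fix z∉ψ))
                        (cong (inst1 L ψ) (↦-this var z t)))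
                 (map-substF-fresh Δ (fix z∉Δ)))

    base : Cyclic (((s ≐ var z) ∷ inst1 L ψ s ∷ Γ ⊢ inst1 L ψ (var z) ∷ Δ) ∷ [])
    base = infer (core (eqL₁ ψ s (var z)))
      (infer (core (wk (λ { (here p) → here p }) (λ { (here p) → here p })))
        (infer (core (ax (inst1 L ψ s))) empty))

    θ : ℕ → Term L 0
    -- The premise of (Ind) is used for the last step: `a` becomes the intermediate point `w` and
    -- `b` the end point `z`.
    θ = var [ b ↦ var z ] [ a ↦ var w ]

    θ-a : θ a ≡ var w
    θ-a = ↦-this _ a (var w)

    θ-b : θ b ≡ var z
    θ-b = trans (↦-other _ (var w) (a≢b ∘ sym)) (↦-this var b (var z))

    fixθ : ∀ {xs} → a ∉ xs → b ∉ xs → θ fixes xs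
    fixθ a∉ b∉ = ↦-fixes a∉ (↦-fixes b∉ (λ _ → refl))

    step : Cyclic ((inst1 L ψ (var w) ∷ rtc φ s (var w) ∷ inst2 L φ (var w) (var z) ∷ inst1 L ψ s ∷ Γ
                      ⊢ inst1 L ψ (var z) ∷ Δ) ∷ [])
    step = infer (core (wk (λ { (here p) → here p ; (there (here p)) → there (there (here p))
                              ; (there (there p)) → there (there (there (there p))) }) id))
      (infer-subst {S = inst1 L ψ (var w) ∷ inst2 L φ (var w) (var z) ∷ Γ ⊢ inst1 L ψ (var z) ∷ Δ} θ
        (cong₂ _⊢_
          (cong₂ _∷_ (trans (substF-inst1 ψ (var a) (fixθ a∉ψ b∉ψ)) (cong (inst1 L ψ) θ-a))
            (cong₂ _∷_ (trans (substF-inst2 φ (var a) (var b) (fixθ a∉φ b∉φ))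
                              (cong₂ (inst2 L φ) θ-a θ-b))
                       (map-substF-fresh Γ (fixθ a∉Γ b∉Γ))))
          (cong₂ _∷_ (trans (substF-inst1 ψ (var b) (fixθ a∉ψ b∉ψ)) (cong (inst1 L ψ) θ-b))
                     (map-substF-fresh Δ (fixθ a∉Δ b∉Δ))))
        π)

  mutual
    cyclic : ∀ {S} → RTCProof L S → Cyclic (S ∷ [])
    cyclic (by r ds) = infer-ind r (cyclic* ds)

    cyclic* : ∀ {Ss} → All (RTCProof L) Ss → Cyclic Ss
    cyclic* []       = empty
    cyclic* (d ∷ ds) = cyclic d ∷ᶜ cyclic* ds

  RTC⇒CRTC : ∀ {S} → RTCProvable L S → CRTCProvable L S
  RTC⇒CRTC d with cyclic d
  ... | G , (i , refl) ∷ [] = unfold G i , unfold-good G i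

-- Formulas over finitely many symbols and their enumeration by height.

module Restriction (L : Signature) (Fs : List (Signature.Fun L)) (Ps : List (Signature.Pred L)) where
  open Signature L
  open Substitution L

  mutual
    GoodT : ∀ {n} → Term L n → Set
    GoodT (var x)    = ⊤
    GoodT (bvar i)   = ⊤
    GoodT (app f ts) = f ∈ Fs × GoodTs ts

    GoodTs : ∀ {n k} → Vec (Term L n) k → Set
    GoodTs []       = ⊤
    GoodTs (t ∷ ts) = GoodT t × GoodTs ts

  GoodF : ∀ {n} → Form L n → Set
  GoodF (atom P ts) = P ∈ Ps × GoodTs ts
  GoodF (s ≐ t)     = GoodT s × GoodT t
  GoodF (¬' φ)      = GoodF φ
  GoodF (φ ∧' ψ)    = GoodF φ × GoodF ψ
  GoodF (φ ∨' ψ)    = GoodF φ × GoodF ψ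
  GoodF (φ ⇒' ψ)    = GoodF φ × GoodF ψ
  GoodF (∀' φ)      = GoodF φ
  GoodF (∃' φ)      = GoodF φ
  GoodF (rtc φ s t) = GoodF φ × GoodT s × GoodT t

  mutual
    goodT-ren : ∀ {m n} (ρ : Fin m → Fin n) t → GoodT t → GoodT (renT L ρ t)
    goodT-ren ρ (var x)    g        = tt
    goodT-ren ρ (bvar i)   g        = tt
    goodT-ren ρ (app f ts) (f∈ , g) = f∈ , goodTs-ren ρ ts g

    goodTs-ren : ∀ {m n k} (ρ : Fin m → Fin n) (ts : Vec (Term L m) k) →
      GoodTs ts → GoodTs (renTs L ρ ts)
    goodTs-ren ρ []       g        = tt
    goodTs-ren ρ (t ∷ ts) (g , gs) = goodT-ren ρ t g , goodTs-ren ρ ts gs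

  module _ {n : ℕ} {θ : ℕ → Term L n} (gθ : ∀ x → GoodT (θ x)) where
    mutual
      goodT-sub : ∀ {m} {σ : Fin m → Term L n} → (∀ i → GoodT (σ i)) →
        ∀ t → GoodT t → GoodT (subT L θ σ t)
      goodT-sub gσ (var x)    g        = gθ x
      goodT-sub gσ (bvar i)   g        = gσ i
      goodT-sub gσ (app f ts) (f∈ , g) = f∈ , goodTs-sub gσ ts g

      goodTs-sub : ∀ {m k} {σ : Fin m → Term L n} → (∀ i → GoodT (σ i)) →
        (ts : Vec (Term L m) k) → GoodTs ts → GoodTs (subTs L θ σ ts)
      goodTs-sub gσ []       g        = tt
      goodTs-sub gσ (t ∷ ts) (g , gs) = goodT-sub gσ t g , goodTs-sub gσ ts gs

  good-wkS : ∀ {n} {θ : ℕ → Term L n} → (∀ x → GoodT (θ x)) → ∀ x → GoodT (wkS L θ x)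
  good-wkS {θ = θ} gθ x = goodT-ren suc (θ x) (gθ x)

  good-liftS : ∀ {m n} {σ : Fin m → Term L n} → (∀ i → GoodT (σ i)) → ∀ i → GoodT (liftS L σ i)
  good-liftS         gσ zero    = tt
  good-liftS {σ = σ} gσ (suc i) = goodT-ren suc (σ i) (gσ i)

  goodF-sub : ∀ {m n} {θ : ℕ → Term L n} {σ : Fin m → Term L n} →
    (∀ x → GoodT (θ x)) → (∀ i → GoodT (σ i)) → ∀ φ → GoodF φ → GoodF (subF L θ σ φ)
  goodF-sub gθ gσ (atom P ts) (P∈ , g)      = P∈ , goodTs-sub gθ gσ ts g
  goodF-sub gθ gσ (s ≐ t)     (gs , gt)     = goodT-sub gθ gσ s gs , goodT-sub gθ gσ t gt
  goodF-sub gθ gσ (¬' φ)      g             = goodF-sub gθ gσ φ g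
  goodF-sub gθ gσ (φ ∧' ψ)    (g , h)       = goodF-sub gθ gσ φ g , goodF-sub gθ gσ ψ h
  goodF-sub gθ gσ (φ ∨' ψ)    (g , h)       = goodF-sub gθ gσ φ g , goodF-sub gθ gσ ψ h
  goodF-sub gθ gσ (φ ⇒' ψ)    (g , h)       = goodF-sub gθ gσ φ g , goodF-sub gθ gσ ψ h
  goodF-sub gθ gσ (∀' φ)      g             = goodF-sub (good-wkS gθ) (good-liftS gσ) φ g
  goodF-sub gθ gσ (∃' φ)      g             = goodF-sub (good-wkS gθ) (good-liftS gσ) φ g
  goodF-sub gθ gσ (rtc φ s t) (g , gs , gt) =
    goodF-sub (good-wkS (good-wkS gθ)) (good-liftS (good-liftS gσ)) φ g ,
    goodT-sub gθ gσ s gs , goodT-sub gθ gσ t gt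

  good-inst1 : ∀ {n} (φ : Form L (suc n)) t → GoodF φ → GoodT t → GoodF (inst1 L φ t)
  good-inst1 φ t g h = goodF-sub (λ _ → tt) (λ { zero → h ; (suc i) → tt }) φ g

  good-inst2 : ∀ {n} (φ : Form L (suc (suc n))) s t → GoodF φ → GoodT s → GoodT t →
    GoodF (inst2 L φ s t)
  good-inst2 φ s t g gs gt =
    goodF-sub (λ _ → tt) (λ { zero → gs ; (suc zero) → gt ; (suc (suc i)) → tt }) φ g

  -- Heights also dominate the names of free variables, so that only finitely
  -- many good terms and formulas have a given height.
  mutual
    heightT : ∀ {n} → Term L n → ℕ
    heightT (var x)    = suc x
    heightT (bvar i)   = 1
    heightT (app f ts) = suc (heightTs ts)

    heightTs : ∀ {n k} → Vec (Term L n) k → ℕ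
    heightTs []       = 0
    heightTs (t ∷ ts) = heightT t ⊔ heightTs ts

  heightF : ∀ {n} → Form L n → ℕ
  heightF (atom P ts) = suc (heightTs ts)
  heightF (s ≐ t)     = suc (heightT s ⊔ heightT t)
  heightF (¬' φ)      = suc (heightF φ)
  heightF (φ ∧' ψ)    = suc (heightF φ ⊔ heightF ψ)
  heightF (φ ∨' ψ)    = suc (heightF φ ⊔ heightF ψ)
  heightF (φ ⇒' ψ)    = suc (heightF φ ⊔ heightF ψ)
  heightF (∀' φ)      = suc (heightF φ)
  heightF (∃' φ)      = suc (heightF φ)
  heightF (rtc φ s t) = suc (heightF φ ⊔ (heightT s ⊔ heightT t))

  vecs : ∀ {A : Set} → List A → ∀ k → List (Vec A k)
  vecs xs zero    = [] ∷ []
  vecs xs (suc k) = cartesianProductWith _∷_ xs (vecs xs k)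

  mutual
    terms : ℕ → ∀ n → List (Term L n)
    terms zero    n = []
    terms (suc k) n = concat (termGroups k n)

    termGroups : ℕ → ∀ n → List (List (Term L n))
    termGroups k n =
        -- `var x` has height `suc x`, so height `suc k` admits the names up to and including `k`.
        map var (upTo (suc k))
      ∷ map bvar (allFin n)
      ∷ concatMap (λ f → map (app f) (vecs (terms k n) (farity f))) Fs
      ∷ []

  mutual
    forms : ℕ → ∀ n → List (Form L n)
    forms zero    n = []
    forms (suc k) n = concat (formGroups k n)

    formGroups : ℕ → ∀ n → List (List (Form L n))
    formGroups k n =
        concatMap (λ P → map (atom P) (vecs (terms k n) (parity P))) Ps
      ∷ cartesianProductWith _≐_ (terms k n) (terms k n)
      ∷ map ¬'_ (forms k n)
      ∷ cartesianProductWith _∧'_ (forms k n) (forms k n)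
      ∷ cartesianProductWith _∨'_ (forms k n) (forms k n)
      ∷ cartesianProductWith _⇒'_ (forms k n) (forms k n)
      ∷ map ∀'_ (forms k (suc n))
      ∷ map ∃'_ (forms k (suc n))
      ∷ concatMap (λ φ → cartesianProductWith (rtc φ) (terms k n) (terms k n)) (forms k (suc (suc n)))
      ∷ []

  ∈-concatMap : ∀ {A B : Set} (f : A → List B) {x y xs} → x ∈ xs → y ∈ f x → y ∈ concatMap f xs
  ∈-concatMap f x∈ y∈ = ∈-concat⁺′ y∈ (∈-map⁺ f x∈)

  mutual
    ∈-terms : ∀ {n} k (t : Term L n) → GoodT t → heightT t ≤ k → t ∈ terms k n
    ∈-terms (suc k) (var x)    g        h       = ∈-concat⁺′ {xss = termGroups k _} (∈-map⁺ var (∈-upTo⁺ h)) (here refl)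
    ∈-terms (suc k) (bvar i)   g        h       = ∈-concat⁺′ {xss = termGroups k _} (∈-map⁺ bvar (∈-allFin i)) (there (here refl))
    ∈-terms (suc k) (app f ts) (f∈ , g) (s≤s h) = ∈-concat⁺′ {xss = termGroups k _}
      (∈-concatMap (λ f → map (app f) (vecs (terms k _) (farity f))) f∈
        (∈-map⁺ (app f) (∈-vecs k ts g h)))
      (there (there (here refl)))

    ∈-vecs : ∀ {n m} k (ts : Vec (Term L n) m) → GoodTs ts → heightTs ts ≤ k →
      ts ∈ vecs (terms k n) m
    ∈-vecs k []       g        h = here refl
    ∈-vecs k (t ∷ ts) (g , gs) h =
      ∈-cartesianProductWith⁺ _∷_ (∈-terms k t g (ℕₚ.m⊔n≤o⇒m≤o _ _ h))
                                  (∈-vecs k ts gs (ℕₚ.m⊔n≤o⇒n≤o (heightT t) _ h))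

  ∈-forms : ∀ {n} k (φ : Form L n) → GoodF φ → heightF φ ≤ k → φ ∈ forms k n
  ∈-forms (suc k) (atom P ts) (P∈ , g) (s≤s h) = ∈-concat⁺′ {xss = formGroups k _}
    (∈-concatMap (λ P → map (atom P) (vecs (terms k _) (parity P))) P∈
      (∈-map⁺ (atom P) (∈-vecs k ts g h)))
    (here refl)
  ∈-forms (suc k) (s ≐ t) (gs , gt) (s≤s h) = ∈-concat⁺′ {xss = formGroups k _}
    (∈-cartesianProductWith⁺ _≐_ (∈-terms k s gs (ℕₚ.m⊔n≤o⇒m≤o _ _ h))
                                 (∈-terms k t gt (ℕₚ.m⊔n≤o⇒n≤o (heightT s) _ h)))
    (there (here refl))
  ∈-forms (suc k) (¬' φ) g (s≤s h) = ∈-concat⁺′ {xss = formGroups k _}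
    (∈-map⁺ ¬'_ (∈-forms k φ g h))
    (there (there (here refl)))
  ∈-forms (suc k) (φ ∧' ψ) (g , g') (s≤s h) = ∈-concat⁺′ {xss = formGroups k _}
    (∈-cartesianProductWith⁺ _∧'_ (∈-forms k φ g (ℕₚ.m⊔n≤o⇒m≤o _ _ h))
                                  (∈-forms k ψ g' (ℕₚ.m⊔n≤o⇒n≤o (heightF φ) _ h)))
    (there (there (there (here refl))))
  ∈-forms (suc k) (φ ∨' ψ) (g , g') (s≤s h) = ∈-concat⁺′ {xss = formGroups k _}
    (∈-cartesianProductWith⁺ _∨'_ (∈-forms k φ g (ℕₚ.m⊔n≤o⇒m≤o _ _ h))
                                  (∈-forms k ψ g' (ℕₚ.m⊔n≤o⇒n≤o (heightF φ) _ h)))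
    (there (there (there (there (here refl)))))
  ∈-forms (suc k) (φ ⇒' ψ) (g , g') (s≤s h) = ∈-concat⁺′ {xss = formGroups k _}
    (∈-cartesianProductWith⁺ _⇒'_ (∈-forms k φ g (ℕₚ.m⊔n≤o⇒m≤o _ _ h))
                                  (∈-forms k ψ g' (ℕₚ.m⊔n≤o⇒n≤o (heightF φ) _ h)))
    (there (there (there (there (there (here refl))))))
  ∈-forms (suc k) (∀' φ) g (s≤s h) = ∈-concat⁺′ {xss = formGroups k _}
    (∈-map⁺ ∀'_ (∈-forms k φ g h))
    (there (there (there (there (there (there (here refl)))))))
  ∈-forms (suc k) (∃' φ) g (s≤s h) = ∈-concat⁺′ {xss = formGroups k _}
    (∈-map⁺ ∃'_ (∈-forms k φ g h))
    (there (there (there (there (there (there (there (here refl))))))))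
  ∈-forms (suc k) (rtc φ s t) (g , gs , gt) (s≤s h) = ∈-concat⁺′ {xss = formGroups k _}
    (∈-concatMap (λ φ → cartesianProductWith (rtc φ) (terms k _) (terms k _))
      (∈-forms k φ g (ℕₚ.m⊔n≤o⇒m≤o _ _ h))
      (∈-cartesianProductWith⁺ (rtc φ)
        (∈-terms k s gs (ℕₚ.m⊔n≤o⇒m≤o _ _ h'))
        (∈-terms k t gt (ℕₚ.m⊔n≤o⇒n≤o (heightT s) _ h'))))
    (there (there (there (there (there (there (there (there (here refl)))))))))
    where h' = ℕₚ.m⊔n≤o⇒n≤o (heightF φ) _ h

-- Derived inferences of the finitary calculus.

module Calculus (L : Signature) where
  open Substitution L

  Prov : Sequent L → Set
  Prov = RTCProof L

  infer₀ : ∀ {C} → Core L C [] → Prov C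
  infer₀ r = by (core r) []

  infer₁ : ∀ {C P} → Core L C (P ∷ []) → Prov P → Prov C
  infer₁ r d = by (core r) (d ∷ [])

  infer₂ : ∀ {C P Q} → Core L C (P ∷ Q ∷ []) → Prov P → Prov Q → Prov C
  infer₂ r d e = by (core r) (d ∷ e ∷ [])

  identity : ∀ {Γ Δ φ} → φ ∈ Γ → φ ∈ Δ → Prov (Γ ⊢ Δ)
  identity {φ = φ} p q = infer₁ (wk (λ { (here refl) → p }) (λ { (here refl) → q })) (infer₀ (ax φ))

  contractL : ∀ {Γ Δ φ} → φ ∈ Γ → Prov (φ ∷ Γ ⊢ Δ) → Prov (Γ ⊢ Δ)
  contractL p = infer₁ (wk (λ { (here refl) → p ; (there q) → q }) id)

  convertL : ∀ {Γ Δ φ φ'} → φ ≡ φ' → Prov (φ' ∷ Γ ⊢ Δ) → Prov (φ ∷ Γ ⊢ Δ)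
  convertL refl d = d

  contractR : ∀ {Γ Δ φ} → φ ∈ Δ → Prov (Γ ⊢ φ ∷ Δ) → Prov (Γ ⊢ Δ)
  contractR p = infer₁ (wk id (λ { (here refl) → p ; (there q) → q }))

-- A complete theory with Henkin witnesses.

module Lindenbaum (em : ExcludedMiddle 0ℓ) (L : Signature)
  (Fs : List (Signature.Fun L)) (Ps : List (Signature.Pred L))
  (S₀ : Sequent L) (S₀-unprovable : ¬ RTCProof L S₀) where
  open Substitution L
  open Restriction L Fs Ps
  open Calculus L

  witL : Form L 0 → ℕ → List (Form L 0)
  witL (∃' ψ) a = inst1 L ψ (var a) ∷ []
  witL _      a = []

  witR : Form L 0 → ℕ → List (Form L 0)
  witR (∀' ψ) a = inst1 L ψ (var a) ∷ []
  witR _      a = []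

  -- The quantified formula is duplicated first, so that it remains beside its witness; the
  -- eigenvariable condition then has to cover the remaining copy as well.
  witL-sound : ∀ {Γ Δ} φ a → a ∉ fvF L φ → a ∉ fvL L Γ → a ∉ fvL L Δ →
    Prov (witL φ a ++ φ ∷ Γ ⊢ Δ) → Prov (φ ∷ Γ ⊢ Δ)
  witL-sound (∃' ψ) a a∉φ a∉Γ a∉Δ d = contractL (here refl)
    (infer₁ (exL ψ a a∉φ ([ a∉φ , a∉Γ ] ∘ ∈-++⁻ (fvF L ψ)) a∉Δ) d)
  witL-sound (atom P ts) a _ _ _ d = d
  witL-sound (s ≐ t)     a _ _ _ d = d
  witL-sound (¬' φ)      a _ _ _ d = d
  witL-sound (φ ∧' ψ)    a _ _ _ d = d
  witL-sound (φ ∨' ψ)    a _ _ _ d = d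
  witL-sound (φ ⇒' ψ)    a _ _ _ d = d
  witL-sound (∀' φ)      a _ _ _ d = d
  witL-sound (rtc φ s t) a _ _ _ d = d

  witR-sound : ∀ {Γ Δ} φ a → a ∉ fvF L φ → a ∉ fvL L Γ → a ∉ fvL L Δ →
    Prov (Γ ⊢ witR φ a ++ φ ∷ Δ) → Prov (Γ ⊢ φ ∷ Δ)
  witR-sound (∀' ψ) a a∉φ a∉Γ a∉Δ d = contractR (here refl)
    (infer₁ (allR ψ a a∉φ a∉Γ ([ a∉φ , a∉Δ ] ∘ ∈-++⁻ (fvF L ψ))) d)
  witR-sound (atom P ts) a _ _ _ d = d
  witR-sound (s ≐ t)     a _ _ _ d = d
  witR-sound (¬' φ)      a _ _ _ d = d
  witR-sound (φ ∧' ψ)    a _ _ _ d = d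
  witR-sound (φ ∨' ψ)    a _ _ _ d = d
  witR-sound (φ ⇒' ψ)    a _ _ _ d = d
  witR-sound (∃' φ)      a _ _ _ d = d
  witR-sound (rtc φ s t) a _ _ _ d = d

  freshName : Form L 0 → Sequent L → ℕ
  freshName φ (Γ ⊢ Δ) = proj₁ (fresh-for (fvF L φ ∷ fvL L Γ ∷ fvL L Δ ∷ []))

  -- If adding `φ` on the left yields a provable sequent, then by cut adding it on the right cannot.
  -- The witness is added in the same move, when only finitely many names have to be avoided.
  decide : Form L 0 → Sequent L → Sequent L
  decide φ (Γ ⊢ Δ) with em {Prov (φ ∷ Γ ⊢ Δ)}
  ... | no  _ = witL φ (freshName φ (Γ ⊢ Δ)) ++ φ ∷ Γ ⊢ Δ
  ... | yes _ = Γ ⊢ witR φ (freshName φ (Γ ⊢ Δ)) ++ φ ∷ Δ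

  decide-unprovable : ∀ φ S → ¬ Prov S → ¬ Prov (decide φ S)
  decide-unprovable φ (Γ ⊢ Δ) ¬d
    with em {Prov (φ ∷ Γ ⊢ Δ)} | proj₂ (fresh-for (fvF L φ ∷ fvL L Γ ∷ fvL L Δ ∷ []))
  ... | no ¬e | a∉φ ∷ a∉Γ ∷ a∉Δ ∷ [] = ¬e ∘ witL-sound φ _ a∉φ a∉Γ a∉Δ
  ... | yes e | a∉φ ∷ a∉Γ ∷ a∉Δ ∷ [] = λ d →
    ¬d (infer₂ (cut φ) (witR-sound φ _ a∉φ a∉Γ a∉Δ d) e)

  infix 4 _⊑_
  _⊑_ : Sequent L → Sequent L → Set
  S ⊑ S' = ante S ⊆ ante S' × succ S ⊆ succ S'

  decide-⊒ : ∀ φ S → S ⊑ decide φ S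
  decide-⊒ φ (Γ ⊢ Δ) with em {Prov (φ ∷ Γ ⊢ Δ)}
  ... | no  _ = ∈-++⁺ʳ (witL φ _) ∘ there , id
  ... | yes _ = id , ∈-++⁺ʳ (witR φ _) ∘ there

  Decided : Form L 0 → Sequent L → Set
  Decided φ S =
      (φ ∈ ante S × ∀ {ψ} → φ ≡ ∃' ψ → ∃ λ a → inst1 L ψ (var a) ∈ ante S)
    ⊎ (φ ∈ succ S × ∀ {ψ} → φ ≡ ∀' ψ → ∃ λ a → inst1 L ψ (var a) ∈ succ S)

  decided-⊑ : ∀ {φ S S'} → S ⊑ S' → Decided φ S → Decided φ S'
  decided-⊑ (p , q) (inj₁ (φ∈ , w)) = inj₁ (p φ∈ , λ e → let a , h = w e in a , p h)
  decided-⊑ (p , q) (inj₂ (φ∈ , w)) = inj₂ (q φ∈ , λ e → let a , h = w e in a , q h)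

  decide-decided : ∀ φ S → Decided φ (decide φ S)
  decide-decided φ (Γ ⊢ Δ) with em {Prov (φ ∷ Γ ⊢ Δ)}
  ... | no  _ = inj₁ (∈-++⁺ʳ (witL φ _) (here refl) , λ { refl → _ , here refl })
  ... | yes _ = inj₂ (∈-++⁺ʳ (witR φ _) (here refl) , λ { refl → _ , here refl })

  decideAll : List (Form L 0) → Sequent L → Sequent L
  decideAll []       S = S
  decideAll (φ ∷ φs) S = decideAll φs (decide φ S)

  decideAll-unprovable : ∀ φs S → ¬ Prov S → ¬ Prov (decideAll φs S)
  decideAll-unprovable []       S ¬d = ¬d
  decideAll-unprovable (φ ∷ φs) S ¬d = decideAll-unprovable φs _ (decide-unprovable φ S ¬d)

  decideAll-⊒ : ∀ φs S → S ⊑ decideAll φs S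
  decideAll-⊒ []       S = id , id
  decideAll-⊒ (φ ∷ φs) S =
    let p , q = decide-⊒ φ S ; p' , q' = decideAll-⊒ φs (decide φ S) in p' ∘ p , q' ∘ q

  decideAll-decided : ∀ {φ} φs S → φ ∈ φs → Decided φ (decideAll φs S)
  decideAll-decided (φ ∷ φs) S (here refl) = decided-⊑ (decideAll-⊒ φs _) (decide-decided φ S)
  decideAll-decided (φ ∷ φs) S (there p)   = decideAll-decided φs _ p

  -- A formula of height at most `k` is decided again at each later stage. This is harmless:
  -- unprovability of the stages forces it onto the same side every time.
  stage : ℕ → Sequent L
  stage zero    = S₀
  stage (suc k) = decideAll (forms k 0) (stage k)

  stage-unprovable : ∀ k → ¬ Prov (stage k)
  stage-unprovable zero    = S₀-unprovable
  stage-unprovable (suc k) = decideAll-unprovable (forms k 0) _ (stage-unprovable k)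

  stage-mono : ∀ {j k} → j ≤ k → stage j ⊑ stage k
  stage-mono j≤k = go (ℕₚ.≤⇒≤′ j≤k)
    where
    go : ∀ {j k} → j ≤′ k → stage j ⊑ stage k
    go ≤′-refl             = id , id
    go (≤′-step {n = k} p) = let p , q = go p ; p' , q' = decideAll-⊒ (forms k 0) (stage k) in p' ∘ p , q' ∘ q

  T F : Form L 0 → Set
  T φ = ∃ λ k → φ ∈ ante (stage k)
  F φ = ∃ λ k → φ ∈ succ (stage k)

  private
    boundT : ∀ {Γ} → All T Γ → ∃ λ k → Γ ⊆ ante (stage k)
    boundT []             = 0 , λ ()
    boundT ((j , p) ∷ ps) = let k , Γ⊆ = boundT ps in
      j ⊔ k , λ { (here refl) → proj₁ (stage-mono (ℕₚ.m≤m⊔n j k)) p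
                ; (there q)   → proj₁ (stage-mono (ℕₚ.m≤n⊔m j k)) (Γ⊆ q) }

    boundF : ∀ {Δ} → All F Δ → ∃ λ k → Δ ⊆ succ (stage k)
    boundF []             = 0 , λ ()
    boundF ((j , p) ∷ ps) = let k , Δ⊆ = boundF ps in
      j ⊔ k , λ { (here refl) → proj₂ (stage-mono (ℕₚ.m≤m⊔n j k)) p
                ; (there q)   → proj₂ (stage-mono (ℕₚ.m≤n⊔m j k)) (Δ⊆ q) }

  -- The stages increase and a sequent is finite, so a single unprovable stage contains it whole.
  consistent : ∀ {Γ Δ} → All T Γ → All F Δ → ¬ Prov (Γ ⊢ Δ)
  consistent ts fs d =
    let j , Γ⊆ = boundT ts ; k , Δ⊆ = boundF fs in
    stage-unprovable (j ⊔ k) (infer₁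
      (wk (proj₁ (stage-mono (ℕₚ.m≤m⊔n j k)) ∘ Γ⊆) (proj₂ (stage-mono (ℕₚ.m≤n⊔m j k)) ∘ Δ⊆)) d)

  ¬TF : ∀ {φ} → T φ → ¬ F φ
  ¬TF t f = consistent (t ∷ []) (f ∷ []) (infer₀ (ax _))

  decided : ∀ {φ} → GoodF φ →
      (T φ × ∀ {ψ} → φ ≡ ∃' ψ → ∃ λ a → T (inst1 L ψ (var a)))
    ⊎ (F φ × ∀ {ψ} → φ ≡ ∀' ψ → ∃ λ a → F (inst1 L ψ (var a)))
  decided {φ} g
    with decideAll-decided (forms (heightF φ) 0) (stage (heightF φ)) (∈-forms _ φ g ℕₚ.≤-refl)
  ... | inj₁ (p , w) = inj₁ ((suc (heightF φ) , p) , λ e → let a , q = w e in a , suc (heightF φ) , q)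
  ... | inj₂ (p , w) = inj₂ ((suc (heightF φ) , p) , λ e → let a , q = w e in a , suc (heightF φ) , q)

  T-or-F : ∀ {φ} → GoodF φ → T φ ⊎ F φ
  T-or-F g = Sum.map proj₁ proj₁ (decided g)

  ¬T⇒F : ∀ {φ} → GoodF φ → ¬ T φ → F φ
  ¬T⇒F g ¬t = [ ⊥-elim ∘ ¬t , id ] (T-or-F g)

  T-closed : ∀ {Γ φ} → All T Γ → GoodF φ → Prov (Γ ⊢ φ ∷ []) → T φ
  T-closed ts g d = [ id , (λ f → ⊥-elim (consistent ts (f ∷ []) d)) ] (T-or-F g)

  T-∃-witness : ∀ {ψ} → GoodF ψ → T (∃' ψ) → ∃ λ a → T (inst1 L ψ (var a))
  T-∃-witness g t with decided g
  ... | inj₁ (_ , w) = w refl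
  ... | inj₂ (f , _) = ⊥-elim (¬TF t f)

  F-∀-witness : ∀ {ψ} → GoodF ψ → F (∀' ψ) → ∃ λ a → F (inst1 L ψ (var a))
  F-∀-witness g f with decided g
  ... | inj₂ (_ , w) = w refl
  ... | inj₁ (t , _) = ⊥-elim (¬TF t f)

-- Closure of the theory under connectives, quantifiers and equality.

module Truth (em : ExcludedMiddle 0ℓ) (L : Signature)
  (Fs : List (Signature.Fun L)) (Ps : List (Signature.Pred L))
  (S₀ : Sequent L) (S₀-unprovable : ¬ RTCProof L S₀) where
  open Substitution L
  open Restriction L Fs Ps
  open Calculus L
  open Lindenbaum em L Fs Ps S₀ S₀-unprovable

  T-¬⁻ : ∀ {φ} → T (¬' φ) → ¬ T φ
  T-¬⁻ t u = consistent (t ∷ u ∷ []) [] (infer₁ (negL _) (identity (here refl) (here refl)))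

  T-¬⁺ : ∀ {φ} → GoodF φ → ¬ T φ → T (¬' φ)
  T-¬⁺ g ¬t = [ id , (λ f → ⊥-elim (consistent [] (f ∷ ¬T⇒F g ¬t ∷ [])
    (infer₁ (negR _) (identity (here refl) (here refl))))) ] (T-or-F g)

  T-∧⁻ : ∀ {φ ψ} → GoodF (φ ∧' ψ) → T (φ ∧' ψ) → T φ × T ψ
  T-∧⁻ (g , h) t =
    T-closed (t ∷ []) g (infer₁ (andL _ _) (identity (here refl) (here refl))) ,
    T-closed (t ∷ []) h (infer₁ (andL _ _) (identity (there (here refl)) (here refl)))

  T-∧⁺ : ∀ {φ ψ} → GoodF (φ ∧' ψ) → T φ → T ψ → T (φ ∧' ψ)
  T-∧⁺ g t u = T-closed (t ∷ u ∷ []) g (infer₂ (andR _ _)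
    (identity (here refl) (here refl)) (identity (there (here refl)) (here refl)))

  T-∨⁻ : ∀ {φ ψ} → GoodF (φ ∨' ψ) → T (φ ∨' ψ) → T φ ⊎ T ψ
  T-∨⁻ (g , h) t with T-or-F g | T-or-F h
  ... | inj₁ u | _      = inj₁ u
  ... | inj₂ _ | inj₁ u = inj₂ u
  ... | inj₂ f | inj₂ f' = ⊥-elim (consistent (t ∷ []) (f ∷ f' ∷ []) (infer₂ (orL _ _)
    (identity (here refl) (here refl)) (identity (here refl) (there (here refl)))))

  T-∨⁺ : ∀ {φ ψ} → GoodF (φ ∨' ψ) → T φ ⊎ T ψ → T (φ ∨' ψ)
  T-∨⁺ g (inj₁ t) = T-closed (t ∷ []) g (infer₁ (orR _ _) (identity (here refl) (here refl)))
  T-∨⁺ g (inj₂ t) = T-closed (t ∷ []) g (infer₁ (orR _ _) (identity (here refl) (there (here refl))))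

  T-⇒⁻ : ∀ {φ ψ} → GoodF (φ ⇒' ψ) → T (φ ⇒' ψ) → T φ → T ψ
  T-⇒⁻ (g , h) t u = T-closed (t ∷ u ∷ []) h (infer₂ (impL _ _)
    (identity (here refl) (here refl)) (identity (here refl) (here refl)))

  T-⇒⁺ : ∀ {φ ψ} → GoodF (φ ⇒' ψ) → (T φ → T ψ) → T (φ ⇒' ψ)
  T-⇒⁺ (g , h) k with T-or-F g
  ... | inj₁ t = T-closed (k t ∷ []) (g , h)
    (infer₁ (impR _ _) (identity (there (here refl)) (here refl)))
  ... | inj₂ f = [ id , (λ f' → ⊥-elim (consistent [] (f' ∷ f ∷ [])
    (infer₁ (impR _ _) (identity (here refl) (there (here refl)))))) ] (T-or-F (g , h))

  T-∀⁻ : ∀ {φ} t → GoodF φ → GoodT t → T (∀' φ) → T (inst1 L φ t)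
  T-∀⁻ {φ} t g gt u = T-closed (u ∷ []) (good-inst1 φ t g gt)
    (infer₁ (allL φ t) (identity (here refl) (here refl)))

  -- Were `∀' φ` on the right, a counterexample at some name would have been placed there too. This
  -- is why later arguments need to consider instances at names only, not at all terms.
  T-∀⁺ : ∀ {φ} → GoodF φ → (∀ a → T (inst1 L φ (var a))) → T (∀' φ)
  T-∀⁺ g h with T-or-F g
  ... | inj₁ t = t
  ... | inj₂ f = let a , f' = F-∀-witness g f in ⊥-elim (¬TF (h a) f')

  T-∃⁺ : ∀ {φ} t → GoodF φ → T (inst1 L φ t) → T (∃' φ)
  T-∃⁺ {φ} t g u = T-closed (u ∷ []) g (infer₁ (exR φ t) (identity (here refl) (here refl)))

  T-≐-refl : ∀ {t} → GoodT t → T (t ≐ t)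
  T-≐-refl {t} g = T-closed [] (g , g) (infer₀ (eqR t))

  T-replace : ∀ φ {s t} → GoodF φ → GoodT t → T (s ≐ t) → T (inst1 L φ s) → T (inst1 L φ t)
  T-replace φ {s} {t} g gt e u = T-closed (e ∷ u ∷ []) (good-inst1 φ t g gt)
    (infer₁ (eqL₁ φ s t) (identity (here refl) (here refl)))

  -- Replaces the arguments one at a time: the first is the hole of a unary
  -- context, and once replaced it is absorbed into the formula.
  T-cong : ∀ {m} (φ : Form L m) {σ τ : Fin m → Term L 0} → GoodF φ →
    (∀ i → GoodT (σ i)) → (∀ i → GoodT (τ i)) → (∀ i → T (σ i ≐ τ i)) →
    T (subF L var σ φ) → T (subF L var τ φ)
  T-cong {zero}  φ g gσ gτ e t = Eq.subst T (subF-cong φ (λ _ → refl) (λ ())) t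
  T-cong {suc m} φ {σ} {τ} g gσ gτ e t =
    Eq.subst T (trans rest-eq (▹-η τ))
      (T-cong rest {σ ∘ suc} {τ ∘ suc} good-rest (gσ ∘ suc) (gτ ∘ suc) (e ∘ suc)
        (Eq.subst T (trans head-eq (sym rest-eq))
          (T-replace head good-head (gτ zero) (e zero)
            (Eq.subst T (sym (trans head-eq (▹-η σ))) t))))
    where
    ▹-η : ∀ υ → subF L var ((υ ∘ suc) ▹ υ zero) φ ≡ subF L var υ φ
    ▹-η υ = subF-cong φ (λ _ → refl) λ { zero → refl ; (suc i) → refl }

    head : Form L 1
    head = subF L var ((weaken L ∘ σ ∘ suc) ▹ bvar zero) φ

    good-head : GoodF head
    good-head = goodF-sub (λ _ → tt) (λ { zero → tt ; (suc i) → goodT-ren suc (σ (suc i)) (gσ (suc i)) }) φ g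

    head-eq : ∀ {u} → inst1 L head u ≡ subF L var ((σ ∘ suc) ▹ u) φ
    head-eq = trans (subF-subF _ _ _ _ φ)
      (subF-cong φ (λ _ → refl) λ { zero → refl ; (suc i) → inst-weaken (σ (suc i)) })

    rest : Form L m
    rest = subF L var (bvar ▹ renT L (λ ()) (τ zero)) φ

    good-rest : GoodF rest
    good-rest = goodF-sub (λ _ → tt) (λ { zero → goodT-ren _ (τ zero) (gτ zero) ; (suc i) → tt }) φ g

    rest-eq : ∀ {υ : Fin m → Term L 0} → subF L var υ rest ≡ subF L var (υ ▹ τ zero) φ
    rest-eq = trans (subF-subF _ _ _ _ φ) (subF-cong φ (λ _ → refl)
      λ { zero → trans (sub-renT _ _ _ (τ zero)) (subT-fresh (τ zero) (λ _ → refl) (λ ()))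
        ; (suc i) → refl })

  T-≐-sym : ∀ {s t} → GoodT s → GoodT t → T (s ≐ t) → T (t ≐ s)
  T-≐-sym {s} {t} gs gt e =
    T-cong (bvar zero ≐ bvar (suc zero)) {σ₂ L s s} {σ₂ L t s} (tt , tt)
      (λ { zero → gs ; (suc zero) → gs }) (λ { zero → gt ; (suc zero) → gs })
      (λ { zero → e ; (suc zero) → T-≐-refl gs }) (T-≐-refl gs)

  T-≐-trans : ∀ {s t u} → GoodT s → GoodT t → GoodT u → T (s ≐ t) → T (t ≐ u) → T (s ≐ u)
  T-≐-trans {s} {t} {u} gs gt gu e e' =
    T-cong (bvar zero ≐ bvar (suc zero)) {σ₂ L s t} {σ₂ L s u} (tt , tt)
      (λ { zero → gs ; (suc zero) → gt }) (λ { zero → gs ; (suc zero) → gu })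
      (λ { zero → T-≐-refl gs ; (suc zero) → e' }) e

  goodTs-lookup : ∀ {n k} (ts : Vec (Term L n) k) → GoodTs ts → ∀ i → GoodT (Vec.lookup ts i)
  goodTs-lookup (t ∷ ts) (g , gs) zero    = g
  goodTs-lookup (t ∷ ts) (g , gs) (suc i) = goodTs-lookup ts gs i

  goodTs-bvars : ∀ {n k} (f : Fin k → Fin n) → GoodTs (Vec.tabulate (bvar {L} ∘ f))
  goodTs-bvars {k = zero}  f = tt
  goodTs-bvars {k = suc k} f = tt , goodTs-bvars (f ∘ suc)

  subTs-bvars : ∀ {m n k} {θ : ℕ → Term L n} (σ : Fin m → Term L n) (f : Fin k → Fin m) →
    subTs L θ σ (Vec.tabulate (bvar ∘ f)) ≡ Vec.tabulate (σ ∘ f)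
  subTs-bvars {k = zero}  σ f = refl
  subTs-bvars {k = suc k} σ f = cong (σ (f zero) ∷_) (subTs-bvars σ (f ∘ suc))

  subTs-lookup : ∀ {n k} {θ : ℕ → Term L n} (ts : Vec (Term L n) k) →
    subTs L θ (Vec.lookup ts) (Vec.tabulate bvar) ≡ ts
  subTs-lookup ts = trans (subTs-bvars (Vec.lookup ts) id) (tabulate∘lookup ts)

  T-atom-cong : ∀ {P} {ts us : Vec (Term L 0) (Signature.parity L P)} → P ∈ Ps →
    GoodTs ts → GoodTs us → (∀ i → T (Vec.lookup ts i ≐ Vec.lookup us i)) →
    T (atom P ts) → T (atom P us)
  T-atom-cong {P} {ts} {us} P∈ gt gu e t =
    Eq.subst (T ∘ atom P) (subTs-lookup us)
      (T-cong (atom P (Vec.tabulate bvar)) (P∈ , goodTs-bvars id)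
        (goodTs-lookup ts gt) (goodTs-lookup us gu) e
        (Eq.subst (T ∘ atom P) (sym (subTs-lookup ts)) t))

  -- `T-cong` is applied to an equation whose left side `app f ts` contains no hole and whose right
  -- side has a hole for every argument: at `ts` it is reflexivity, at `us` it is the claim.
  T-app-cong : ∀ {f} {ts us : Vec (Term L 0) (Signature.farity L f)} → f ∈ Fs →
    GoodTs ts → GoodTs us → (∀ i → T (Vec.lookup ts i ≐ Vec.lookup us i)) →
    T (app f ts ≐ app f us)
  T-app-cong {f} {ts} {us} f∈ gt gu e =
    Eq.subst T (cong₂ (λ vs ws → app f vs ≐ app f ws) const-ts (subTs-lookup us))
      (T-cong (app f (renTs L (λ ()) ts) ≐ app f (Vec.tabulate bvar))
        ((f∈ , goodTs-ren _ ts gt) , f∈ , goodTs-bvars id)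
        (goodTs-lookup ts gt) (goodTs-lookup us gu) e
        (Eq.subst T (sym (cong₂ (λ vs ws → app f vs ≐ app f ws) const-ts (subTs-lookup ts)))
          (T-≐-refl (f∈ , gt))))
    where
    const-ts : ∀ {m} {σ : Fin m → Term L 0} → subTs L var σ (renTs L (λ ()) ts) ≡ ts
    const-ts = trans (sub-renTs _ _ _ ts)
      (trans (subTs-cong ts (λ _ → refl) (λ ())) (subTs-id ts))

  -- Reflexive transitive closure inside the theory.

  module _ (χ : Form L 2) (ψ : Form L 1) where
    at : Fin 2 → Form L 2
    at i = subF L var (λ _ → bvar i) ψ

    -- Closure of the set defined by `ψ` under `χ`. Index 0 is the source and index 1 the target, as
    -- in the body of an `rtc`; in `∀' ∀' closedness` the outer quantifier therefore binds the
    -- target.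
    closedness : Form L 2
    closedness = (at zero ∧' χ) ⇒' at (suc zero)

    inst-at : ∀ i u w → inst2 L (at i) u w ≡ inst1 L ψ (σ₂ L u w i)
    inst-at i u w = trans (subF-subF _ _ _ _ ψ) (subF-cong ψ (λ _ → refl) λ { zero → refl })

    inst-closedness : ∀ u w →
      inst1 L (subF L (wkS L var) (liftS L (σ₁ L w)) closedness) u ≡
      (inst1 L ψ u ∧' inst2 L χ u w) ⇒' inst1 L ψ w
    inst-closedness u w = trans
      (trans (inst1-lift var (σ₁ L w) closedness u)
        (subF-cong closedness (λ _ → refl) λ { zero → refl ; (suc zero) → refl }))
      (cong₂ (λ φ φ' → (φ ∧' inst2 L χ u w) ⇒' φ') (inst-at zero u w) (inst-at (suc zero) u w))

    ind-provable : ∀ s t →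
      Prov (inst1 L ψ s ∷ rtc χ s t ∷ (∀' ∀' closedness) ∷ [] ⊢ inst1 L ψ t ∷ [])
    ind-provable s t
      with fresh-for (fvF L ψ ∷ fvF L χ ∷ fvL L ((∀' ∀' closedness) ∷ []) ∷ [])
    ... | a , a∉ψ ∷ a∉χ ∷ a∉K ∷ []
      with fresh-for ((a ∷ []) ∷ fvF L ψ ∷ fvF L χ ∷ fvL L ((∀' ∀' closedness) ∷ []) ∷ [])
    ... | b , b∉a ∷ b∉ψ ∷ b∉χ ∷ b∉K ∷ [] =
      by (ind ψ χ s t a b (λ { refl → b∉a (here refl) })
            a∉K (λ ()) a∉ψ a∉χ b∉K (λ ()) b∉ψ b∉χ) (premise ∷ [])
      where
      premise : Prov (inst1 L ψ (var a) ∷ inst2 L χ (var a) (var b) ∷ (∀' ∀' closedness) ∷ []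
                        ⊢ inst1 L ψ (var b) ∷ [])
      premise = contractL (there (there (here refl)))
        -- The target `b` is instantiated before the source `a`, following the order of the
        -- quantifiers.
        (infer₁ (allL (∀' closedness) (var b))
        (infer₁ (allL (subF L (wkS L var) (liftS L (σ₁ L (var b))) closedness) (var a))
        (convertL (inst-closedness (var a) (var b))
        (infer₂ (impL _ _)
          (infer₂ (andR _ _) (identity (here refl) (here refl))
                             (identity (there (here refl)) (here refl)))
          (identity (here refl) (here refl))))))

    -- The step hypothesis is about membership in T, not derivability, so (Ind) cannot consume it
    -- directly. Because names suffice for `T-∀⁺`, it becomes the universal closure of `closedness`
    -- inside T, which then serves as the side formula in `ind-provable`.
    T-rtc⁻ : ∀ {s t} → GoodF χ → GoodF ψ → GoodT s → GoodT t →
      T (rtc χ s t) → T (inst1 L ψ s) →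
      (∀ a b → T (inst1 L ψ (var a)) → T (inst2 L χ (var a) (var b)) → T (inst1 L ψ (var b))) →
      T (inst1 L ψ t)
    T-rtc⁻ {s} {t} gχ gψ gs gt r u step =
      T-closed (u ∷ r ∷ T-∀⁺ good (λ b → T-∀⁺ (good-sub b) (λ a →
          Eq.subst T (sym (inst-closedness (var a) (var b)))
            (T-⇒⁺ (good-step a b) (λ h → let p , q = T-∧⁻ (proj₁ (good-step a b)) h in step a b p q)))) ∷ [])
        (good-inst1 ψ t gψ gt) (ind-provable s t)
      where
      good : GoodF closedness
      good = (goodF-sub (λ _ → tt) (λ _ → tt) ψ gψ , gχ) , goodF-sub (λ _ → tt) (λ _ → tt) ψ gψ

      good-sub : ∀ b → GoodF (subF L (wkS L var) (liftS L (σ₁ L (var b))) closedness)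
      good-sub b = goodF-sub (λ _ → tt) (good-liftS λ { zero → tt }) closedness good

      good-step : ∀ a b → GoodF ((inst1 L ψ (var a) ∧' inst2 L χ (var a) (var b)) ⇒' inst1 L ψ (var b))
      good-step a b = (good-inst1 ψ (var a) gψ tt , good-inst2 χ (var a) (var b) gχ tt tt) ,
                      good-inst1 ψ (var b) gψ tt

  -- The definable set of points reachable from `s`, with the hole as target. Its body is `χ` moved
  -- to a scope with one more bound variable, the hole, which does not occur in it.
  reachable : Form L 2 → Term L 0 → Form L 1
  reachable χ s = rtc (subF L (wkS L (wkS L var)) (liftS L (liftS L (λ ()))) χ) (weaken L s) (bvar zero)

  inst-reachable : ∀ χ s t → inst1 L (reachable χ s) t ≡ rtc χ s t
  inst-reachable χ s t = cong₂ (λ χ s → rtc χ s t)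
    (trans (subF-subF _ _ _ _ χ) (subF-fresh χ (λ _ → refl) λ { zero → refl ; (suc zero) → refl }))
    (inst-weaken s)

  good-reachable : ∀ χ s → GoodF χ → GoodT s → GoodF (reachable χ s)
  good-reachable χ s gχ gs =
    goodF-sub (λ _ → tt) (good-liftS (good-liftS λ ())) χ gχ , goodT-ren suc s gs , tt

  T-rtc-refl : ∀ χ {s} → GoodF χ → GoodT s → T (rtc χ s s)
  T-rtc-refl χ gχ gs = T-closed [] (gχ , gs , gs) (infer₀ (rtcRefl χ _))

  T-rtc-trans : ∀ {χ s r t} → GoodF χ → GoodT s → GoodT t →
    T (rtc χ s r) → T (inst2 L χ r t) → T (rtc χ s t)
  T-rtc-trans {χ} {s} {r} {t} gχ gs gt u u' = T-closed (u ∷ u' ∷ []) (gχ , gs , gt)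
    (infer₂ (rtcTrans χ s r t) (identity (here refl) (here refl))
                               (identity (there (here refl)) (here refl)))

-- The term model.

module Model (em : ExcludedMiddle 0ℓ) (L : Signature)
  (Fs : List (Signature.Fun L)) (Ps : List (Signature.Pred L))
  (S₀ : Sequent L) (S₀-unprovable : ¬ RTCProof L S₀) where
  open Signature L
  open Substitution L
  open Restriction L Fs Ps
  open Lindenbaum em L Fs Ps S₀ S₀-unprovable
  open Truth em L Fs Ps S₀ S₀-unprovable

  first : (Term L 0 → Set) → List (Term L 0) → Term L 0
  first P []       = var 0
  first P (x ∷ xs) with em {P x}
  ... | yes _ = x
  ... | no  _ = first P xs

  first-sat : ∀ {P : Term L 0 → Set} {x xs} → x ∈ xs → P x → P (first P xs)
  first-sat {P} {x} {y ∷ xs} x∈ p with em {P y}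
  first-sat                  x∈          p | yes q = q
  first-sat                  (here refl) p | no ¬q = ⊥-elim (¬q p)
  first-sat                  (there x∈)  p | no ¬q = first-sat x∈ p

  first-++ : ∀ {P : Term L 0 → Set} {x xs} ys → x ∈ xs → P x → first P (xs ++ ys) ≡ first P xs
  first-++ {P} {x} {y ∷ xs} ys x∈ p with em {P y}
  first-++                  ys x∈          p | yes q = refl
  first-++                  ys (here refl) p | no ¬q = ⊥-elim (¬q p)
  first-++                  ys (there x∈)  p | no ¬q = first-++ ys x∈ p

  first-cong : ∀ {P Q : Term L 0 → Set} xs → (∀ {x} → P x → Q x) → (∀ {x} → Q x → P x) → first P xs ≡ first Q xs
  first-cong         []       f g = refl
  first-cong {P} {Q} (x ∷ xs) f g with em {P x} | em {Q x}
  ... | yes p | yes q = refl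
  ... | yes p | no ¬q = ⊥-elim (¬q (f p))
  ... | no ¬p | yes q = ⊥-elim (¬p (g q))
  ... | no ¬p | no ¬q = first-cong xs f g

  -- In general `terms n 0` is not an initial segment of `terms (suc n) 0`. Appending the lists
  -- makes each an initial segment of the next, so a successful search keeps its result when the
  -- bound grows.
  termsUpTo : ℕ → List (Term L 0)
  termsUpTo zero    = []
  termsUpTo (suc n) = termsUpTo n ++ terms (suc n) 0

  ∈-termsUpTo : ∀ t → GoodT t → t ∈ termsUpTo (heightT t)
  ∈-termsUpTo t g = go (heightT t) (∈-terms (heightT t) t g ℕₚ.≤-refl)
    where
    go : ∀ n → t ∈ terms n 0 → t ∈ termsUpTo n
    go (suc n) p = ∈-++⁺ʳ (termsUpTo n) p

  first-stable : ∀ (P : Term L 0 → Set) {x m n} → m ≤ n → x ∈ termsUpTo m → P x →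
    first P (termsUpTo n) ≡ first P (termsUpTo m)
  first-stable P {x} {m} m≤n x∈ p = go (ℕₚ.≤⇒≤′ m≤n)
    where
    mem : ∀ {n} → m ≤′ n → x ∈ termsUpTo n
    mem ≤′-refl     = x∈
    mem (≤′-step l) = ∈-++⁺ˡ (mem l)
    go : ∀ {n} → m ≤′ n → first P (termsUpTo n) ≡ first P (termsUpTo m)
    go ≤′-refl             = refl
    go (≤′-step {n = n} l) = trans (first-++ (terms (suc n) 0) (mem l) p) (go l)

  Class : Term L 0 → Term L 0 → Set
  Class t u = GoodT u × T (t ≐ u)

  rep : Term L 0 → Term L 0
  rep t = first (Class t) (termsUpTo (heightT t))

  rep-class : ∀ {t} → GoodT t → Class t (rep t)
  rep-class {t} g = first-sat {Class t} (∈-termsUpTo t g) (g , T-≐-refl g)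

  -- Both searches can be prolonged to the larger of the two heights without changing their results,
  -- and over that common list the two classes coincide.
  rep-cong : ∀ {t u} → GoodT t → GoodT u → T (t ≐ u) → rep t ≡ rep u
  rep-cong {t} {u} gt gu e =
    trans (sym (first-stable (Class t) (ℕₚ.m≤m⊔n (heightT t) (heightT u)) (∈-termsUpTo t gt) (gt , T-≐-refl gt)))
    (trans (first-cong (termsUpTo (heightT t ⊔ heightT u))
             (λ { (g , e') → g , T-≐-trans gu gt g (T-≐-sym gt gu e) e' })
             (λ { (g , e') → g , T-≐-trans gt gu g e e' }))
           (first-stable (Class u) (ℕₚ.m≤n⊔m (heightT t) (heightT u)) (∈-termsUpTo u gu) (gu , T-≐-refl gu)))

  -- Canonical representatives stand in for the quotient of the terms by provable
  -- equality; irrelevance makes elements equal as soon as their terms are.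
  record Dom : Set where
    constructor dom
    field
      tm     : Term L 0
      .good  : GoodT tm
      .canon : rep tm ≡ tm
  open Dom using (tm)

  tm-good : ∀ d → GoodT (tm d)
  tm-good (dom t g _) = recompute em g

  tm-canon : ∀ d → rep (tm d) ≡ tm d
  tm-canon (dom t _ c) = recompute em c

  tm-injective : ∀ {d e} → tm d ≡ tm e → d ≡ e
  tm-injective {dom t _ _} {dom .t _ _} refl = refl

  class : ∀ t → GoodT t → Dom
  class t g = dom (rep t) (proj₁ (rep-class g))
    (sym (rep-cong g (proj₁ (rep-class g)) (proj₂ (rep-class g))))

  infix 4 _≈_
  -- `t` is a term denoting `d`. A relation is used because the truth lemma has to substitute names
  -- in some cases and canonical representatives in others.
  record _≈_ (t : Term L 0) (d : Dom) : Set where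
    constructor _,_
    field
      ≈-good : GoodT t
      ≈-T    : T (t ≐ tm d)
  open _≈_

  ≈-class : ∀ {t} (g : GoodT t) → t ≈ class t g
  ≈-class g = g , proj₂ (rep-class g)

  tm-≈ : ∀ d → tm d ≈ d
  tm-≈ d = tm-good d , T-≐-refl (tm-good d)

  ≈-sym : ∀ {t d} → t ≈ d → T (tm d ≐ t)
  ≈-sym {t} {d} (g , e) = T-≐-sym g (tm-good d) e

  goodTs-tm : ∀ {k} (ds : Vec Dom k) → GoodTs (Vec.map tm ds)
  goodTs-tm []       = tt
  goodTs-tm (d ∷ ds) = tm-good d , goodTs-tm ds

  d₀ : Dom
  d₀ = class (var 0) tt

  funI′ : ∀ f → Dec (f ∈ Fs) → Vec Dom (farity f) → Dom
  funI′ f (yes f∈) ds = class (app f (Vec.map tm ds)) (f∈ , goodTs-tm ds)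
  funI′ f (no  _)  ds = d₀

  -- The Henkin family consists of the sets defined by good formulas with one hole; their parameters
  -- are terms written into the formula.
  M : Frame L
  M = record
    { D     = Dom
    ; funI  = λ f → funI′ f em
    ; predI = λ P ds → P ∈ Ps × T (atom P (Vec.map tm ds))
    ; Idx   = Σ (Form L 1) GoodF
    ; mem   = λ (ψ , _) d → T (inst1 L ψ (tm d))
    }

  -- Symbols outside Fs and Ps are interpreted trivially: the free name 0 is
  -- reserved for their value, all other names being shifted by one.
  mutual
    trT : ∀ {n} → Term L n → Term L n
    trT (var x)    = var (suc x)
    trT (bvar i)   = bvar i
    trT (app f ts) with em {f ∈ Fs}
    ... | yes _ = app f (trTs ts)
    ... | no  _ = var 0

    trTs : ∀ {n k} → Vec (Term L n) k → Vec (Term L n) k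
    trTs []       = []
    trTs (t ∷ ts) = trT t ∷ trTs ts

  trF : ∀ {n} → Form L n → Form L n
  trF (atom P ts) with em {P ∈ Ps}
  ... | yes _ = atom P (trTs ts)
  -- False in every structure, to match `predI`, which is empty for predicates outside `Ps`.
  ... | no  _ = ¬' (var 0 ≐ var 0)
  trF (s ≐ t)     = trT s ≐ trT t
  trF (¬' φ)      = ¬' trF φ
  trF (φ ∧' ψ)    = trF φ ∧' trF ψ
  trF (φ ∨' ψ)    = trF φ ∨' trF ψ
  trF (φ ⇒' ψ)    = trF φ ⇒' trF ψ
  trF (∀' φ)      = ∀' trF φ
  trF (∃' φ)      = ∃' trF φ
  trF (rtc φ s t) = rtc (trF φ) (trT s) (trT t)

  mutual
    good-trT : ∀ {n} (t : Term L n) → GoodT (trT t)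
    good-trT (var x)    = tt
    good-trT (bvar i)   = tt
    good-trT (app f ts) with em {f ∈ Fs}
    ... | yes f∈ = f∈ , good-trTs ts
    ... | no  _  = tt

    good-trTs : ∀ {n k} (ts : Vec (Term L n) k) → GoodTs (trTs ts)
    good-trTs []       = tt
    good-trTs (t ∷ ts) = good-trT t , good-trTs ts

  good-trF : ∀ {n} (φ : Form L n) → GoodF (trF φ)
  good-trF (atom P ts) with em {P ∈ Ps}
  ... | yes P∈ = P∈ , good-trTs ts
  ... | no  _  = tt , tt
  good-trF (s ≐ t)     = good-trT s , good-trT t
  good-trF (¬' φ)      = good-trF φ
  good-trF (φ ∧' ψ)    = good-trF φ , good-trF ψ
  good-trF (φ ∨' ψ)    = good-trF φ , good-trF ψ
  good-trF (φ ⇒' ψ)    = good-trF φ , good-trF ψ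
  good-trF (∀' φ)      = good-trF φ
  good-trF (∃' φ)      = good-trF φ
  good-trF (rtc φ s t) = good-trF φ , good-trT s , good-trT t

  mutual
    sub-trT : ∀ {n} {θ : ℕ → Term L n} {σ : Fin n → Term L n} →
      (∀ x → θ (suc x) ≡ var x) → (∀ i → σ i ≡ bvar i) →
      ∀ t → GoodT t → subT L θ σ (trT t) ≡ t
    sub-trT eθ eσ (var x)    g = eθ x
    sub-trT eθ eσ (bvar i)   g = eσ i
    sub-trT eθ eσ (app f ts) (f∈ , g) with em {f ∈ Fs}
    ... | yes _ = cong (app f) (sub-trTs eθ eσ ts g)
    ... | no ¬p = ⊥-elim (¬p f∈)

    sub-trTs : ∀ {n k} {θ : ℕ → Term L n} {σ : Fin n → Term L n} →
      (∀ x → θ (suc x) ≡ var x) → (∀ i → σ i ≡ bvar i) →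
      (ts : Vec (Term L n) k) → GoodTs ts → subTs L θ σ (trTs ts) ≡ ts
    sub-trTs eθ eσ []       g        = refl
    sub-trTs eθ eσ (t ∷ ts) (g , gs) = cong₂ _∷_ (sub-trT eθ eσ t g) (sub-trTs eθ eσ ts gs)

  liftS-id : ∀ {n} {σ : Fin n → Term L n} → (∀ i → σ i ≡ bvar i) → ∀ i → liftS L σ i ≡ bvar i
  liftS-id e i = trans (liftS-cong e i) (liftS-bvar i)

  rtc-cong : ∀ {n φ φ'} {s s' t t' : Term L n} → φ ≡ φ' → s ≡ s' → t ≡ t' → rtc φ s t ≡ rtc φ' s' t'
  rtc-cong refl refl refl = refl

  -- Without foreign symbols the translation merely shifts names, and `θ` shifts them back. This
  -- recovers the formulas of `S₀` from the truth lemma, which speaks of translated formulas.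
  sub-trF : ∀ {n} {θ : ℕ → Term L n} {σ : Fin n → Term L n} →
    (∀ x → θ (suc x) ≡ var x) → (∀ i → σ i ≡ bvar i) →
    ∀ φ → GoodF φ → subF L θ σ (trF φ) ≡ φ
  sub-trF eθ eσ (atom P ts) (P∈ , g) with em {P ∈ Ps}
  ... | yes _ = cong (atom P) (sub-trTs eθ eσ ts g)
  ... | no ¬p = ⊥-elim (¬p P∈)
  sub-trF eθ eσ (s ≐ t)     (g , h) = cong₂ _≐_ (sub-trT eθ eσ s g) (sub-trT eθ eσ t h)
  sub-trF eθ eσ (¬' φ)      g       = cong ¬'_ (sub-trF eθ eσ φ g)
  sub-trF eθ eσ (φ ∧' ψ)    (g , h) = cong₂ _∧'_ (sub-trF eθ eσ φ g) (sub-trF eθ eσ ψ h)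
  sub-trF eθ eσ (φ ∨' ψ)    (g , h) = cong₂ _∨'_ (sub-trF eθ eσ φ g) (sub-trF eθ eσ ψ h)
  sub-trF eθ eσ (φ ⇒' ψ)    (g , h) = cong₂ _⇒'_ (sub-trF eθ eσ φ g) (sub-trF eθ eσ ψ h)
  sub-trF eθ eσ (∀' φ)      g       = cong ∀'_ (sub-trF (wkS-fixed ∘ eθ) (liftS-id eσ) φ g)
  sub-trF eθ eσ (∃' φ)      g       = cong ∃'_ (sub-trF (wkS-fixed ∘ eθ) (liftS-id eσ) φ g)
  sub-trF eθ eσ (rtc φ s t) (g , gs , gt) =
    rtc-cong (sub-trF (wkS-fixed ∘ wkS-fixed ∘ eθ) (liftS-id (liftS-id eσ)) φ g)
             (sub-trT eθ eσ s gs) (sub-trT eθ eσ t gt)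

  -- The truth lemma for translated formulas.

  module _ {θ : ℕ → Term L 0} {v : ℕ → Dom} (θ₀ : θ 0 ≈ d₀) (θ≈v : ∀ x → θ (suc x) ≈ v x) where
    good-θ : ∀ x → GoodT (θ x)
    good-θ zero    = ≈-good θ₀
    good-θ (suc x) = ≈-good (θ≈v x)

    mutual
      eval-≈ : ∀ {n} {σ : Fin n → Term L 0} {ρ : Fin n → Dom} → (∀ i → σ i ≈ ρ i) →
        ∀ t → subT L θ σ (trT t) ≈ evalT L M v ρ t
      eval-≈ σ≈ρ (var x)    = θ≈v x
      eval-≈ σ≈ρ (bvar i)   = σ≈ρ i
      eval-≈ {σ = σ} {ρ} σ≈ρ (app f ts) with em {f ∈ Fs}
      ... | no  _  = θ₀
      ... | yes f∈ =
        let gs = goodTs-sub good-θ (≈-good ∘ σ≈ρ) (trTs ts) (good-trTs ts)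
            gd = goodTs-tm (evalTs L M v ρ ts)
        in (f∈ , gs) ,
           T-≐-trans (f∈ , gs) (f∈ , gd) (tm-good (class (app f (Vec.map tm (evalTs L M v ρ ts))) (f∈ , gd)))
             (T-app-cong f∈ gs gd (evals-≈ σ≈ρ ts)) (≈-T (≈-class {app f (Vec.map tm (evalTs L M v ρ ts))} (f∈ , gd)))

      evals-≈ : ∀ {n k} {σ : Fin n → Term L 0} {ρ : Fin n → Dom} → (∀ i → σ i ≈ ρ i) →
        (ts : Vec (Term L n) k) → ∀ i →
        T (Vec.lookup (subTs L θ σ (trTs ts)) i ≐ Vec.lookup (Vec.map tm (evalTs L M v ρ ts)) i)
      evals-≈ σ≈ρ (t ∷ ts) zero    = ≈-T (eval-≈ σ≈ρ t)
      evals-≈ σ≈ρ (t ∷ ts) (suc i) = evals-≈ σ≈ρ ts i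

    ▹-≈ : ∀ {n} {σ : Fin n → Term L 0} {ρ : Fin n → Dom} {t d} → (∀ i → σ i ≈ ρ i) → t ≈ d →
      ∀ i → (σ ▹ t) i ≈ ext L M ρ d i
    ▹-≈ σ≈ρ t≈d zero    = t≈d
    ▹-≈ σ≈ρ t≈d (suc i) = σ≈ρ i

    module _ {n : ℕ} {σ : Fin n → Term L 0} {ρ : Fin n → Dom} (σ≈ρ : ∀ i → σ i ≈ ρ i) where
      good : ∀ φ → GoodF (subF L θ σ (trF φ))
      good φ = goodF-sub good-θ (≈-good ∘ σ≈ρ) (trF φ) (good-trF φ)

      good₁ : ∀ φ → GoodF (subF L (wkS L θ) (liftS L σ) (trF φ))
      good₁ φ = goodF-sub (good-wkS good-θ) (good-liftS (≈-good ∘ σ≈ρ)) (trF φ) (good-trF φ)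

      good₂ : ∀ φ → GoodF (subF L (wkS L (wkS L θ)) (liftS L (liftS L σ)) (trF φ))
      good₂ φ = goodF-sub (good-wkS (good-wkS good-θ)) (good-liftS (good-liftS (≈-good ∘ σ≈ρ)))
                              (trF φ) (good-trF φ)

    mutual
      -- Negation and implication swap the two directions, so both are proved together. The
      -- recursion is structural on the untranslated `φ`: a binder extends `σ` and `ρ` in parallel,
      -- and `inst1-lift` or `inst2-lift` identifies the result with an instance in T.
      sat⇒T : ∀ {n} {σ : Fin n → Term L 0} {ρ : Fin n → Dom} → (∀ i → σ i ≈ ρ i) →
        ∀ φ → Sat L M v ρ φ → T (subF L θ σ (trF φ))
      sat⇒T {σ = σ} {ρ} σ≈ρ (atom P ts) (P∈ , t) with em {P ∈ Ps}
      ... | no ¬p = ⊥-elim (¬p P∈)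
      ... | yes _ = let gs = goodTs-sub good-θ (≈-good ∘ σ≈ρ) (trTs ts) (good-trTs ts)
                        gd = goodTs-tm (evalTs L M v ρ ts) in
        T-atom-cong P∈ gd gs
          (λ i → T-≐-sym (goodTs-lookup _ gs i) (goodTs-lookup _ gd i) (evals-≈ σ≈ρ ts i)) t
      sat⇒T {ρ = ρ} σ≈ρ (s ≐ t) e =
        T-≐-trans (≈-good (eval-≈ σ≈ρ s)) (tm-good (evalT L M v ρ s)) (≈-good (eval-≈ σ≈ρ t))
          (≈-T (eval-≈ σ≈ρ s))
          (Eq.subst (λ d → T (tm d ≐ _)) (sym e) (≈-sym (eval-≈ σ≈ρ t)))
      sat⇒T σ≈ρ (¬' φ)   h       = T-¬⁺ (good σ≈ρ φ) (h ∘ T⇒sat σ≈ρ φ)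
      sat⇒T σ≈ρ (φ ∧' ψ) (h , k) = T-∧⁺ (good σ≈ρ (φ ∧' ψ)) (sat⇒T σ≈ρ φ h) (sat⇒T σ≈ρ ψ k)
      sat⇒T σ≈ρ (φ ∨' ψ) h       = T-∨⁺ (good σ≈ρ (φ ∨' ψ)) (Sum.map (sat⇒T σ≈ρ φ) (sat⇒T σ≈ρ ψ) h)
      sat⇒T σ≈ρ (φ ⇒' ψ) h       =
        T-⇒⁺ (good σ≈ρ (φ ⇒' ψ)) (sat⇒T σ≈ρ ψ ∘ h ∘ T⇒sat σ≈ρ φ)
      sat⇒T {σ = σ} σ≈ρ (∀' φ) h = T-∀⁺ (good₁ σ≈ρ φ) λ a →
        Eq.subst T (sym (inst1-lift θ σ (trF φ) (var a)))
          (sat⇒T (▹-≈ σ≈ρ (≈-class tt)) φ (h (class (var a) tt)))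
      sat⇒T {σ = σ} σ≈ρ (∃' φ) (d , h) = T-∃⁺ (tm d) (good₁ σ≈ρ φ)
        (Eq.subst T (sym (inst1-lift θ σ (trF φ) (tm d)))
          (sat⇒T (▹-≈ σ≈ρ (tm-≈ d)) φ h))
      -- `mem` tests a set at canonical representatives, so both end points are moved between their
      -- terms and their representatives by `T-replace`.
      sat⇒T {σ = σ} {ρ} σ≈ρ (rtc φ s t) h =
        Eq.subst T (inst-reachable χ s′ _)
          (T-replace ψ gψ (≈-good (eval-≈ σ≈ρ t)) (≈-sym (eval-≈ σ≈ρ t))
            (h (ψ , gψ)
              (T-replace ψ gψ (tm-good (evalT L M v ρ s)) (≈-T (eval-≈ σ≈ρ s))
                (Eq.subst T (sym (inst-reachable χ s′ s′)) (T-rtc-refl χ gχ gs)))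
              λ a b p q → Eq.subst T (sym (inst-reachable χ s′ (tm b)))
                (T-rtc-trans gχ gs (tm-good b) (Eq.subst T (inst-reachable χ s′ (tm a)) p)
                  (Eq.subst T (sym (inst2-lift θ σ (trF φ) (tm a) (tm b)))
                    (sat⇒T (▹-≈ (▹-≈ σ≈ρ (tm-≈ b)) (tm-≈ a)) φ q)))))
        where
        χ  = subF L (wkS L (wkS L θ)) (liftS L (liftS L σ)) (trF φ)
        gχ = good₂ σ≈ρ φ
        s′ = subT L θ σ (trT s)
        gs = ≈-good (eval-≈ σ≈ρ s)
        ψ  = reachable χ s′
        gψ = good-reachable χ s′ gχ gs

      T⇒sat : ∀ {n} {σ : Fin n → Term L 0} {ρ : Fin n → Dom} → (∀ i → σ i ≈ ρ i) →
        ∀ φ → T (subF L θ σ (trF φ)) → Sat L M v ρ φ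
      T⇒sat {σ = σ} {ρ} σ≈ρ (atom P ts) t with em {P ∈ Ps}
      ... | no ¬p  = ⊥-elim (T-¬⁻ t (T-≐-refl (good-θ 0)))
      ... | yes P∈ = P∈ , T-atom-cong P∈
        (goodTs-sub good-θ (≈-good ∘ σ≈ρ) (trTs ts) (good-trTs ts))
        (goodTs-tm (evalTs L M v ρ ts)) (evals-≈ σ≈ρ ts) t
      T⇒sat {ρ = ρ} σ≈ρ (s ≐ t) e =
        let d = evalT L M v ρ s ; d' = evalT L M v ρ t
            es = eval-≈ σ≈ρ s ; et = eval-≈ σ≈ρ t in
        tm-injective (trans (sym (tm-canon d)) (trans
          (rep-cong (tm-good d) (tm-good d')
            (T-≐-trans (tm-good d) (≈-good es) (tm-good d') (≈-sym es)
              (T-≐-trans (≈-good es) (≈-good et) (tm-good d') e (≈-T et))))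
          (tm-canon d')))
      T⇒sat σ≈ρ (¬' φ)   t = T-¬⁻ t ∘ sat⇒T σ≈ρ φ
      T⇒sat σ≈ρ (φ ∧' ψ) t =
        let u , w = T-∧⁻ (good σ≈ρ (φ ∧' ψ)) t in T⇒sat σ≈ρ φ u , T⇒sat σ≈ρ ψ w
      T⇒sat σ≈ρ (φ ∨' ψ) t = Sum.map (T⇒sat σ≈ρ φ) (T⇒sat σ≈ρ ψ) (T-∨⁻ (good σ≈ρ (φ ∨' ψ)) t)
      T⇒sat σ≈ρ (φ ⇒' ψ) t = T⇒sat σ≈ρ ψ ∘ T-⇒⁻ (good σ≈ρ (φ ⇒' ψ)) t ∘ sat⇒T σ≈ρ φ
      T⇒sat {σ = σ} σ≈ρ (∀' φ) t d = T⇒sat (▹-≈ σ≈ρ (tm-≈ d)) φ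
        (Eq.subst T (inst1-lift θ σ (trF φ) (tm d))
          (T-∀⁻ (tm d) (good₁ σ≈ρ φ) (tm-good d) t))
      T⇒sat {σ = σ} σ≈ρ (∃' φ) t =
        let a , u = T-∃-witness (good₁ σ≈ρ φ) t in
        class (var a) tt , T⇒sat (▹-≈ σ≈ρ (≈-class tt)) φ
          (Eq.subst T (inst1-lift θ σ (trF φ) (var a)) u)
      -- Closure of the set is given at elements of the model, whereas `T-rtc⁻` asks for it at
      -- names; every name `a` has its class `x a` as an element.
      T⇒sat {σ = σ} {ρ} σ≈ρ (rtc φ s t) r (ψ , gψ) p step =
        T-replace ψ gψ (tm-good (evalT L M v ρ t)) (≈-T (eval-≈ σ≈ρ t))
          (T-rtc⁻ _ ψ (good₂ σ≈ρ φ) gψ (≈-good (eval-≈ σ≈ρ s)) (≈-good (eval-≈ σ≈ρ t)) r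
            (T-replace ψ gψ (≈-good (eval-≈ σ≈ρ s)) (≈-sym (eval-≈ σ≈ρ s)) p)
            λ a b u w → T-replace ψ gψ tt (≈-sym (x≈ b))
              (step (x a) (x b)
                (T-replace ψ gψ (tm-good (x a)) (≈-T (x≈ a)) u)
                (T⇒sat (▹-≈ (▹-≈ σ≈ρ (x≈ b)) (x≈ a)) φ
                  (Eq.subst T (inst2-lift θ σ (trF φ) (var a) (var b)) w))))
        where
        x : ℕ → Dom
        x a = class (var a) tt
        x≈ : ∀ a → var a ≈ x a
        x≈ a = ≈-class tt

  -- The defining formula is the translation of `φ` with a hole in place of `x` and with the values
  -- of all other names written in as terms. Filling the hole with `tm a` gives the substitution
  -- that represents the updated valuation, so the truth lemma applies.
  isHenkin : IsHenkin L M
  isHenkin φ x v = (ψ , gψ) , λ a →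
    (λ h → T⇒sat (tm-≈ d₀) (λ y → tm-≈ _) (λ ()) φ (Eq.subst T (inst-ψ a) h)) ,
    (λ h → Eq.subst T (sym (inst-ψ a)) (sat⇒T (tm-≈ d₀) (λ y → tm-≈ _) (λ ()) φ h))
    where
    hole : ℕ → Term L 1
    -- Name 0 is the reserved one; a name `y` of `φ` has become `suc y`.
    hole zero    = weaken L (tm d₀)
    hole (suc y) with y ≟ x
    ... | yes _ = bvar zero
    ... | no  _ = weaken L (tm (v y))

    filled : Dom → ℕ → Term L 0
    filled a zero    = tm d₀
    filled a (suc y) = tm (update L M v x a y)

    ψ : Form L 1
    ψ = subF L hole (λ ()) (trF φ)

    good-hole : ∀ y → GoodT (hole y)
    good-hole zero    = goodT-ren suc (tm d₀) (tm-good d₀)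
    good-hole (suc y) with y ≟ x
    ... | yes _ = tt
    ... | no  _ = goodT-ren suc (tm (v y)) (tm-good (v y))

    gψ : GoodF ψ
    gψ = goodF-sub good-hole (λ ()) (trF φ) (good-trF φ)

    fill : ∀ a y → subT L var (σ₁ L (tm a)) (hole y) ≡ filled a y
    fill a zero    = inst-weaken (tm d₀)
    fill a (suc y) with y ≟ x
    ... | yes _ = refl
    ... | no  _ = inst-weaken (tm (v y))

    inst-ψ : ∀ a → inst1 L ψ (tm a) ≡ subF L (filled a) (λ ()) (trF φ)
    inst-ψ a = trans (subF-subF _ _ _ _ (trF φ)) (subF-cong (trF φ) (λ {y} _ → fill a y) (λ ()))

  countermodel : All GoodF (ante S₀) → All GoodF (succ S₀) → ¬ HenkinValid L S₀
  countermodel gΓ gΔ valid = refute (valid M isHenkin v (All.tabulate satΓ))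
    where
    θ : ℕ → Term L 0
    -- `d₀` is the class of `var 0`, so the reserved name can be sent there, although the shifted
    -- copy of name 0 is sent there as well.
    θ zero    = var 0
    θ (suc x) = var x

    v : ℕ → Dom
    v x = class (var x) tt

    satΓ : ∀ {φ} → φ ∈ ante S₀ → Sat L M v (noBound L M) φ
    satΓ {φ} φ∈ = T⇒sat {θ} (≈-class tt) (λ x → ≈-class tt) {σ = λ ()} (λ ()) φ
      (Eq.subst T (sym (sub-trF (λ _ → refl) (λ ()) φ (All.lookup gΓ φ∈))) (0 , φ∈))

    refute : ¬ Any (λ φ → Sat L M v (noBound L M) φ) (succ S₀)
    refute p = let φ , φ∈ , h = find p in
      ¬TF (Eq.subst T (sub-trF (λ _ → refl) (λ ()) φ (All.lookup gΔ φ∈))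
            (sat⇒T {θ} (≈-class tt) (λ x → ≈-class tt) {σ = λ ()} (λ ()) φ h))
          (0 , φ∈)

-- Symbols occurring in a formula.

module Symbols (L : Signature) where
  open Signature L

  mutual
    funsT : ∀ {n} → Term L n → List Fun
    funsT (var x)    = []
    funsT (bvar i)   = []
    funsT (app f ts) = f ∷ funsTs ts

    funsTs : ∀ {n k} → Vec (Term L n) k → List Fun
    funsTs []       = []
    funsTs (t ∷ ts) = funsT t ++ funsTs ts

  funsF : ∀ {n} → Form L n → List Fun
  funsF (atom P ts) = funsTs ts
  funsF (s ≐ t)     = funsT s ++ funsT t
  funsF (¬' φ)      = funsF φ
  funsF (φ ∧' ψ)    = funsF φ ++ funsF ψ
  funsF (φ ∨' ψ)    = funsF φ ++ funsF ψ
  funsF (φ ⇒' ψ)    = funsF φ ++ funsF ψ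
  funsF (∀' φ)      = funsF φ
  funsF (∃' φ)      = funsF φ
  funsF (rtc φ s t) = funsF φ ++ funsT s ++ funsT t

  predsF : ∀ {n} → Form L n → List Pred
  predsF (atom P ts) = P ∷ []
  predsF (s ≐ t)     = []
  predsF (¬' φ)      = predsF φ
  predsF (φ ∧' ψ)    = predsF φ ++ predsF ψ
  predsF (φ ∨' ψ)    = predsF φ ++ predsF ψ
  predsF (φ ⇒' ψ)    = predsF φ ++ predsF ψ
  predsF (∀' φ)      = predsF φ
  predsF (∃' φ)      = predsF φ
  predsF (rtc φ s t) = predsF φ

  module _ {Fs : List Fun} {Ps : List Pred} where
    open Restriction L Fs Ps

    mutual
      funs-goodT : ∀ {n} (t : Term L n) → funsT t ⊆ Fs → GoodT t
      funs-goodT (var x)    s = tt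
      funs-goodT (bvar i)   s = tt
      funs-goodT (app f ts) s = s (here refl) , funs-goodTs ts (s ∘ there)

      funs-goodTs : ∀ {n k} (ts : Vec (Term L n) k) → funsTs ts ⊆ Fs → GoodTs ts
      funs-goodTs []       s = tt
      funs-goodTs (t ∷ ts) s =
        funs-goodT t (s ∘ ∈-++⁺ˡ) , funs-goodTs ts (s ∘ ∈-++⁺ʳ (funsT t))

    symbols-good : ∀ {n} (φ : Form L n) → funsF φ ⊆ Fs → predsF φ ⊆ Ps → GoodF φ
    symbols-good (atom P ts) f p = p (here refl) , funs-goodTs ts f
    symbols-good (s ≐ t)     f p =
      funs-goodT s (f ∘ ∈-++⁺ˡ) , funs-goodT t (f ∘ ∈-++⁺ʳ (funsT s))
    symbols-good (¬' φ)      f p = symbols-good φ f p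
    symbols-good (φ ∧' ψ)    f p =
      symbols-good φ (f ∘ ∈-++⁺ˡ) (p ∘ ∈-++⁺ˡ) ,
      symbols-good ψ (f ∘ ∈-++⁺ʳ (funsF φ)) (p ∘ ∈-++⁺ʳ (predsF φ))
    symbols-good (φ ∨' ψ)    f p =
      symbols-good φ (f ∘ ∈-++⁺ˡ) (p ∘ ∈-++⁺ˡ) ,
      symbols-good ψ (f ∘ ∈-++⁺ʳ (funsF φ)) (p ∘ ∈-++⁺ʳ (predsF φ))
    symbols-good (φ ⇒' ψ)    f p =
      symbols-good φ (f ∘ ∈-++⁺ˡ) (p ∘ ∈-++⁺ˡ) ,
      symbols-good ψ (f ∘ ∈-++⁺ʳ (funsF φ)) (p ∘ ∈-++⁺ʳ (predsF φ))
    symbols-good (∀' φ)      f p = symbols-good φ f p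
    symbols-good (∃' φ)      f p = symbols-good φ f p
    symbols-good (rtc φ s t) f p =
      symbols-good φ (f ∘ ∈-++⁺ˡ) p ,
      funs-goodT s (f ∘ ∈-++⁺ʳ (funsF φ) ∘ ∈-++⁺ˡ) ,
      funs-goodT t (f ∘ ∈-++⁺ʳ (funsF φ) ∘ ∈-++⁺ʳ (funsT s))

-- Henkin completeness and its transfer to cyclic proofs.

module Completeness (em : ExcludedMiddle 0ℓ) (L : Signature) where
  open Symbols L

  henkin-complete : ∀ S → HenkinValid L S → RTCProvable L S
  henkin-complete S valid with em {RTCProof L S}
  ... | yes d = d
  ... | no ¬d = ⊥-elim (Model.countermodel em L Fs Ps S ¬d
                          (All.tabulate (good ∘ ∈-++⁺ˡ)) (All.tabulate (good ∘ ∈-++⁺ʳ (ante S))) valid)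
    where
    φs = ante S ++ succ S
    Fs = concatMap funsF φs
    Ps = concatMap predsF φs

    good : ∀ {φ} → φ ∈ φs → Restriction.GoodF L Fs Ps φ
    good {φ} φ∈ = symbols-good φ (λ f∈ → ∈-concat⁺′ f∈ (∈-map⁺ funsF φ∈))
                                 (λ P∈ → ∈-concat⁺′ P∈ (∈-map⁺ predsF φ∈))

theorem5 : ExcludedMiddle 0ℓ → (L : Signature) →
    ((S : Sequent L) → RTCProvable L S → CRTCProvable L S) ×
    ((S : Sequent L) → HenkinValid L S → CRTCProvable L S)
theorem5 em L =
  (λ S → RTC⇒CRTC) ,
  (λ S valid → RTC⇒CRTC (henkin-complete S valid))
  where
  open CyclicProofs em L
  open Completeness em L
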